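{- Fix integers $\Delta\ge 2$ and $\gamma\ge 0$, and let $P_{\Delta,\gamma}(n)$ be the number of sweep-covers with exactly $n$ subcovers of the infinite tree $\mathcal{T}_{\Delta,\gamma}$. Then, as $n\to\infty$, $$P_{\Delta,\gamma}(n)=\Omega\left(\frac{\sqrt{2\pi}\,n^{\Delta n+\Delta+\frac32}}{e^{n}\,((\Delta-1)n+\Delta+1)!\,(n+1)!}\,\gamma\right).$$
   Context: All trees are rooted and directed away from the root; nodes are labeled (distinguishable). Ancestors and descendants of a node are strict. A sweep-cover of a tree with vertex set $\mathcal V$ is a collection $S$ of non-empty subsets of $\mathcal V$ (called subcovers) such that: (1) distinct members of $S$ are disjoint; (2) each member of $S$ contains only sibling nodes, i.e. nodes sharing a parent (the singleton of the root is allowed); (3) with $\mathcal C=\bigcup_{S_i\in S}S_i$, every node of $\mathcal V$ is in $\mathcal C$, or is an ancestor of a node of $\mathcal C$, or is a descendant of a node of $\mathcal C$; (4) no node of $\mathcal C$ is an ancestor or descendant of another node of $\mathcal C$. The tree $\mathcal{T}_{\Delta,\gamma}$ is the infinite rooted directed tree all of whose nodes have out-degree $\Delta$ ("$\Delta$-star nodes") or out-degree $1$, arranged so that each child of a $\Delta$-star node is joined to the next $\Delta$-star node below it by a path with exactly $\gamma$ edges (so if $\gamma=0$ the child is itself a $\Delta$-star node); likewise the root is joined to the first $\Delta$-star node by a path with exactly $\gamma$ edges. Thus the subtree of descendants hanging from any child of a $\Delta$-star node is isomorphic to $\mathcal{T}_{\Delta,\gamma}$. $f(n)=\Omega(g(n))$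 means there are a constant $c>0$ and $n_0$ with $f(n)\ge c\,g(n)$ for all $n\ge n_0$. -}

module Defs where

open import Data.Bool.Base using (Bool; T; if_then_else_)
open import Data.Empty using (⊥-elim)
open import Data.Fin.Base using (Fin)
open import Data.Integer.Base as ℤ using (+_; -[1+_])
import Data.Integer.Properties as ℤₚ
open import Data.Nat.Base as ℕ using (ℕ; zero; suc; _!)
import Data.Nat.Properties as ℕₚ
open ℕₚ using (_!≢0)
open import Data.Product.Base using (Σ; ∃; ∃-syntax; _×_; _,_; proj₁; proj₂)
open import Data.Rational as Q using (ℚ; mkℚ; 0ℚ; 1ℚ; ∣_∣)
import Data.Rational.Properties as ℚₚ
open import Data.Rational.Solver using (module +-*-Solver)
import Data.Rational.Unnormalised.Base as ℚᵘ
import Data.Rational.Unnormalised.Properties as ℚᵘₚ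
open import Data.Sum.Base using (_⊎_; inj₁; inj₂)
open import Function.Bundles using (Inverse)
open import Level using (0ℓ)
open import Relation.Binary.Bundles using (Setoid)
open import Relation.Binary.Construct.Closure.Transitive using (TransClosure)
open import Relation.Binary.PropositionalEquality
  using (_≡_; _≢_; _≗_; refl; sym; trans; cong; cong₂; subst; subst₂; setoid)
open import Relation.Nullary.Decidable.Core using (Dec; does; yes; no)
open import Relation.Nullary.Negation.Core using (¬_)

module _ (Δ γ : ℕ) where

  -- `NodeAt k` consists of the nodes lying k edges above the next Δ-star
  -- node; `NodeAt 0` consists of the Δ-star nodes themselves.
  data NodeAt : ℕ → Set where
    root   : NodeAt γ
    along  : ∀ {k} → NodeAt (suc k) → NodeAt k
    branch : NodeAt 0 → Fin Δ → NodeAt γ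

  Node : Set
  Node = ∃ NodeAt

  rootNode : Node
  rootNode = γ , root

  data ParentOf : Node → Node → Set where
    along  : ∀ {k} (u : NodeAt (suc k)) → ParentOf (suc k , u) (k , along u)
    branch : (u : NodeAt 0) (i : Fin Δ) → ParentOf (0 , u) (γ , branch u i)

  AncestorOf : Node → Node → Set
  AncestorOf = TransClosure ParentOf

  Subset : Set
  Subset = Node → Bool

  infix 4 _∈_
  _∈_ : Node → Subset → Set
  v ∈ A = T (A v)

  -- A collection of exactly n subcovers, listed in some order.  Since the
  -- subcovers are non-empty, `disjoint` also says that no subcover is listed
  -- twice.
  record SweepCover (n : ℕ) : Set where
    field
      subcover : Fin n → Subset

    Covered : Node → Set
    Covered v = ∃[ i ] v ∈ subcover i

    field
      nonEmpty  : ∀ i → ∃[ v ] v ∈ subcover i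
      disjoint  : ∀ i j → i ≢ j → ∀ v → v ∈ subcover i → ¬ v ∈ subcover j
      siblings  : ∀ i → (∃[ p ] ∀ v → v ∈ subcover i → ParentOf p v)
                      ⊎ (∀ v → v ∈ subcover i → v ≡ rootNode)
      covering  : ∀ v → Covered v
                      ⊎ (∃[ u ] Covered u × AncestorOf v u)
                      ⊎ (∃[ u ] Covered u × AncestorOf u v)
      antichain : ∀ u v → Covered u → Covered v → ¬ AncestorOf u v

  open SweepCover

  _⊑_ : ∀ {n} → SweepCover n → SweepCover n → Set
  S ⊑ S′ = ∀ i → ∃[ j ] subcover S i ≗ subcover S′ j

  -- Equality is equality of collections: the order of listing is forgotten.
  SweepCovers : ℕ → Setoid 0ℓ 0ℓ
  SweepCovers n = record
    { Carrier       = SweepCover n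
    ; _≈_           = λ S S′ → S ⊑ S′ × S′ ⊑ S
    ; isEquivalence = record
      { refl  = (λ i → i , λ _ → refl) , (λ i → i , λ _ → refl)
      ; sym   = λ (p , q) → q , p
      ; trans = λ (p , q) (p′ , q′) → ⊑-trans p p′ , ⊑-trans q′ q
      }
    }
    where
    ⊑-trans : ∀ {A B C : Fin n → Subset} →
              (∀ i → ∃[ j ] A i ≗ B j) → (∀ i → ∃[ j ] B i ≗ C j) →
              ∀ i → ∃[ j ] A i ≗ C j
    ⊑-trans p q i = let (j , e) = p i ; (k , f) = q j in
                    k , λ v → trans (e v) (f v)

HasCardinality : Setoid 0ℓ 0ℓ → ℕ → Set
HasCardinality A k = Inverse (setoid (Fin k)) A

module Lemmas where
  open Q
  open +-*-Solver

  *-mono : ∀ {r p q} → 0ℚ ≤ r → p ≤ q → r * p ≤ r * q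
  *-mono {r} 0≤r = ℚₚ.*-monoˡ-≤-nonNeg r {{nonNegative 0≤r}}

  *-mono₂ : ∀ {p q r s} → 0ℚ ≤ p → 0ℚ ≤ s → p ≤ q → r ≤ s → p * r ≤ q * s
  *-mono₂ {p} {q} {r} {s} 0≤p 0≤s p≤q r≤s = ℚₚ.≤-trans (*-mono 0≤p r≤s)
    (ℚₚ.*-monoʳ-≤-nonNeg s {{nonNegative 0≤s}} p≤q)

  0≤* : ∀ {p q} → 0ℚ ≤ p → 0ℚ ≤ q → 0ℚ ≤ p * q
  0≤* {p} {q} a b = subst (_≤ p * q) (ℚₚ.*-zeroʳ p) (*-mono a b)

  0<* : ∀ {p q} → 0ℚ < p → 0ℚ < q → 0ℚ < p * q
  0<* {p} {q} a b = ℚₚ.positive⁻¹ (p * q)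
    {{ℚₚ.pos*pos⇒pos p {{positive a}} q {{positive b}}}}

  ε/2+ε/2 : ∀ ε → ε * ½ + ε * ½ ≡ ε
  ε/2+ε/2 ε = trans (sym (ℚₚ.*-distribˡ-+ ε ½ ½)) (ℚₚ.*-identityʳ ε)

  0<½ : 0ℚ < ½
  0<½ = ℚₚ.positive⁻¹ ½

  0<1/ : ∀ {p} .{{_ : NonZero p}} → 0ℚ < p → 0ℚ < 1/ p
  0<1/ {p} {{p≢0}} 0<p = ℚₚ.positive⁻¹ ((1/ p) {{p≢0}}) {{ℚₚ.1/pos⇒pos p {{positive 0<p}}}}

  p≤p+q : ∀ {p q} → 0ℚ ≤ q → p ≤ p + q
  p≤p+q {p} {q} 0≤q = subst (_≤ p + q) (ℚₚ.+-identityʳ p) (ℚₚ.+-monoʳ-≤ p 0≤q)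

  p≤∣p∣ : ∀ p → p ≤ ∣ p ∣
  p≤∣p∣ p with ℚₚ.≤-total 0ℚ p
  ... | inj₁ 0≤p = ℚₚ.≤-reflexive (sym (ℚₚ.0≤p⇒∣p∣≡p 0≤p))
  ... | inj₂ p≤0 = ℚₚ.≤-trans p≤0 (ℚₚ.0≤∣p∣ p)

  p-q≤ε⇒p≤q+ε : ∀ {p q ε} → p - q ≤ ε → p ≤ q + ε
  p-q≤ε⇒p≤q+ε {p} {q} {ε} h =
    subst (_≤ q + ε) (solve 2 (λ x y → y :+ (x :- y) := x) refl p q) (ℚₚ.+-monoʳ-≤ q h)

  p≤q+ε⇒p-q≤ε : ∀ {p q ε} → p ≤ q + ε → p - q ≤ ε
  p≤q+ε⇒p-q≤ε {p} {q} {ε} h =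
    subst (p - q ≤_) (solve 2 (λ y e → y :+ e :- y := e) refl q ε) (ℚₚ.+-monoˡ-≤ (- q) h)

  within : ∀ {p q ε} → ∣ p - q ∣ ≤ ε → p ≤ q + ε
  within {p} {q} h = p-q≤ε⇒p≤q+ε (ℚₚ.≤-trans (p≤∣p∣ (p - q)) h)

  flip-sub : ∀ p q → ∣ p - q ∣ ≡ ∣ q - p ∣
  flip-sub p q = trans (sym (ℚₚ.∣-p∣≡∣p∣ (p - q)))
    (cong ∣_∣ (solve 2 (λ x y → :- (x :- y) := y :- x) refl p q))

  close : ∀ {p q ε} → p ≤ q + ε → q ≤ p + ε → ∣ p - q ∣ ≤ ε
  close {p} {q} {ε} a b with ℚₚ.∣p∣≡p∨∣p∣≡-p (p - q)
  ... | inj₁ e = subst (_≤ ε) (sym e) (p≤q+ε⇒p-q≤ε a)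
  ... | inj₂ e = subst (_≤ ε)
    (trans (solve 2 (λ x y → y :- x := :- (x :- y)) refl p q) (sym e)) (p≤q+ε⇒p-q≤ε b)

  square-cancel : ∀ {p q} → 0ℚ ≤ q → p * p ≤ q * q → p ≤ q
  square-cancel {p} {q} 0≤q h with ℚₚ.≤-total p q
  ... | inj₁ p≤q = p≤q
  ... | inj₂ q≤p with p ℚₚ.≤? q
  ...   | yes p≤q = p≤q
  ...   | no p≰q = ⊥-elim (ℚₚ.<-irrefl refl (ℚₚ.≤-<-trans h
            (ℚₚ.≤-<-trans (*-mono 0≤q q≤p)
              (ℚₚ.*-monoˡ-<-pos p {{positive (ℚₚ.≤-<-trans 0≤q q<p)}} q<p))))
    where q<p = ℚₚ.≰⇒> p≰q

  /-mono : ∀ {a b c d} .{{_ : ℕ.NonZero b}} .{{_ : ℕ.NonZero d}} →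
           a ℕ.* d ℕ.≤ c ℕ.* b → + a / b ≤ + c / d
  /-mono {a} {b@(suc _)} {c} {d@(suc _)} h = ℚₚ.toℚᵘ-cancel-≤
    (ℚᵘₚ.≤-respˡ-≃ (ℚᵘₚ.≃-sym (ℚₚ.toℚᵘ-fromℚᵘ (ℚᵘ.mkℚᵘ (+ a) (ℕ.pred b))))
    (ℚᵘₚ.≤-respʳ-≃ (ℚᵘₚ.≃-sym (ℚₚ.toℚᵘ-fromℚᵘ (ℚᵘ.mkℚᵘ (+ c) (ℕ.pred d))))
    (ℚᵘ.*≤* (subst₂ ℤ._≤_ (ℤₚ.pos-* a d) (ℤₚ.pos-* c b) (ℤ.+≤+ h)))))

  /-+-≤ : ∀ {a b c d e f} .{{_ : ℕ.NonZero b}} .{{_ : ℕ.NonZero d}} .{{_ : ℕ.NonZero f}} →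
          (a ℕ.* d ℕ.+ c ℕ.* b) ℕ.* f ℕ.≤ e ℕ.* (b ℕ.* d) →
          + a / b + + c / d ≤ + e / f
  /-+-≤ {a} {b@(suc _)} {c} {d@(suc _)} {e} {f@(suc _)} h = ℚₚ.toℚᵘ-cancel-≤
    (ℚᵘₚ.≤-respˡ-≃ (ℚᵘₚ.≃-sym (ℚᵘₚ.≃-trans (ℚₚ.toℚᵘ-homo-+ (+ a / b) (+ c / d))
      (ℚᵘₚ.+-cong (ℚₚ.toℚᵘ-fromℚᵘ (ℚᵘ.mkℚᵘ (+ a) (ℕ.pred b)))
                  (ℚₚ.toℚᵘ-fromℚᵘ (ℚᵘ.mkℚᵘ (+ c) (ℕ.pred d))))))
    (ℚᵘₚ.≤-respʳ-≃ (ℚᵘₚ.≃-sym (ℚₚ.toℚᵘ-fromℚᵘ (ℚᵘ.mkℚᵘ (+ e) (ℕ.pred f))))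
    (ℚᵘ.*≤* (subst₂ ℤ._≤_
      (trans (ℤₚ.pos-* (a ℕ.* d ℕ.+ c ℕ.* b) f)
        (cong (ℤ._* + f) (cong₂ ℤ._+_ (ℤₚ.pos-* a d) (ℤₚ.pos-* c b))))
      (ℤₚ.pos-* e (b ℕ.* d)) (ℤ.+≤+ h)))))

  0≤/ : ∀ a b .{{_ : ℕ.NonZero b}} → 0ℚ ≤ + a / b
  0≤/ a b = /-mono {0} {1} {a} {b} ℕ.z≤n

  /-suc : ∀ k m → + suc k / suc m ≡ + k / suc m + + 1 / suc m
  /-suc k m = ℚₚ.toℚᵘ-injective
    (ℚᵘₚ.≃-trans (ℚₚ.toℚᵘ-fromℚᵘ (ℚᵘ.mkℚᵘ (+ suc k) m))
    (ℚᵘₚ.≃-trans sum (ℚᵘₚ.≃-sym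
    (ℚᵘₚ.≃-trans (ℚₚ.toℚᵘ-homo-+ (+ k / suc m) (+ 1 / suc m))
    (ℚᵘₚ.+-cong (ℚₚ.toℚᵘ-fromℚᵘ (ℚᵘ.mkℚᵘ (+ k) m)) (ℚₚ.toℚᵘ-fromℚᵘ (ℚᵘ.mkℚᵘ (+ 1) m)))))))
    where
    d = suc m
    sum : ℚᵘ.mkℚᵘ (+ suc k) m ℚᵘ.≃ ℚᵘ.mkℚᵘ (+ k) m ℚᵘ.+ ℚᵘ.mkℚᵘ (+ 1) m
    sum = ℚᵘ.*≡* (trans (sym (ℤₚ.pos-* (suc k) (d ℕ.* d)))
      (trans (cong +_ nat)
      (trans (ℤₚ.pos-* (k ℕ.* d ℕ.+ 1 ℕ.* d) d)
      (cong (ℤ._* + d) (cong₂ ℤ._+_ (ℤₚ.pos-* k d) (ℤₚ.pos-* 1 d))))))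
      where
      nat : suc k ℕ.* (d ℕ.* d) ≡ (k ℕ.* d ℕ.+ 1 ℕ.* d) ℕ.* d
      nat = trans (sym (ℕₚ.*-assoc (suc k) d d))
        (cong (ℕ._* d) (trans (ℕₚ.+-comm d (k ℕ.* d))
                              (cong (k ℕ.* d ℕ.+_) (sym (ℕₚ.*-identityˡ d)))))

  archimedean : ∀ {ε} → 0ℚ < ε → ∃[ N ] ∀ m → N ℕ.≤ m → + 1 / suc m ≤ ε
  archimedean {ε@(mkℚ (+ suc n) d _)} _ = d , λ m d≤m →
    ℚₚ.≤-trans (/-mono {1} {suc m} {suc n} {suc d}
      (ℕₚ.≤-trans (ℕₚ.≤-reflexive (ℕₚ.*-identityˡ (suc d)))
      (ℕₚ.≤-trans (ℕ.s≤s d≤m) (ℕₚ.m≤m+n (suc m) (n ℕ.* suc m)))))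
      (ℚₚ.≤-reflexive (ℚₚ.↥p/↧p≡p ε))
  archimedean {mkℚ (+ 0) d _} (*<* (ℤ.+<+ ()))
  archimedean {mkℚ -[1+ n ] d _} (*<* ())

open Lemmas

-- Cauchy sequences of rationals; sequences with the same limit are not
-- identified, but `_≤ℝ_` and `Positiveℝ` depend only on the limit.
record ℝ : Set where
  constructor mkℝ
  field
    seq    : ℕ → ℚ
    cauchy : ∀ {ε} → 0ℚ Q.< ε →
             ∃[ N ] ∀ m n → N ℕ.≤ m → N ℕ.≤ n → ∣ seq m Q.- seq n ∣ Q.≤ ε

open ℝ public

infix 4 _≤ℝ_
_≤ℝ_ : ℝ → ℝ → Set
x ≤ℝ y = ∀ {ε} → 0ℚ Q.< ε → ∃[ N ] ∀ m → N ℕ.≤ m → seq x m Q.≤ seq y m Q.+ ε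

Positiveℝ : ℝ → Set
Positiveℝ x = ∃[ δ ] 0ℚ Q.< δ × ∃[ N ] ∀ m → N ℕ.≤ m → δ Q.≤ seq x m

fromℚ : ℚ → ℝ
fromℚ q = mkℝ (λ _ → q) λ 0<ε → 0 , λ _ _ _ _ →
  subst (λ z → ∣ z ∣ Q.≤ _) (sym (ℚₚ.+-inverseʳ q)) (ℚₚ.<⇒≤ 0<ε)

fromℕ : ℕ → ℝ
fromℕ n = fromℚ (+ n Q./ 1)

module _ (x : ℝ) where
  eventualBound : ∃[ B ] 0ℚ Q.< B × ∃[ N ] ∀ m → N ℕ.≤ m → ∣ seq x m ∣ Q.≤ B
  eventualBound with cauchy x (ℚₚ.positive⁻¹ 1ℚ)
  ... | N , close₁ = 1ℚ Q.+ ∣ xN ∣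
      , ℚₚ.<-≤-trans (ℚₚ.positive⁻¹ 1ℚ) (p≤p+q (ℚₚ.0≤∣p∣ xN))
      , N , λ m N≤m → ℚₚ.≤-trans
          (ℚₚ.≤-reflexive (cong ∣_∣ (solve 2 (λ a b → a := (a :- b) :+ b) refl (seq x m) xN)))
          (ℚₚ.≤-trans (ℚₚ.∣p+q∣≤∣p∣+∣q∣ (seq x m Q.- xN) xN)
            (ℚₚ.+-monoˡ-≤ ∣ xN ∣ (close₁ m N N≤m ℕₚ.≤-refl)))
    where
    open +-*-Solver
    xN = seq x N

infixl 7 _*ℝ_
_*ℝ_ : ℝ → ℝ → ℝ
x *ℝ y = mkℝ (λ m → seq x m Q.* seq y m) *-cauchy
  where
  open Q hiding (∣_∣)
  open +-*-Solver
  *-cauchy : ∀ {ε} → 0ℚ < ε → ∃[ N ] ∀ m n → N ℕ.≤ m → N ℕ.≤ n →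
             ∣ seq x m * seq y m - seq x n * seq y n ∣ ≤ ε
  *-cauchy {ε} 0<ε = N , λ m n N≤m N≤n →
    let xm = seq x m ; ym = seq y m ; xn = seq x n ; yn = seq y n in
    ℚₚ.≤-trans (ℚₚ.≤-reflexive (cong ∣_∣
      (solve 4 (λ a b c d → a :* b :- c :* d := a :* (b :- d) :+ d :* (a :- c))
        refl xm ym xn yn)))
    (ℚₚ.≤-trans (ℚₚ.∣p+q∣≤∣p∣+∣q∣ (xm * (ym - yn)) (yn * (xm - xn)))
    (ℚₚ.≤-trans (ℚₚ.≤-reflexive (cong₂ _+_ (ℚₚ.∣p*q∣≡∣p∣*∣q∣ xm (ym - yn))
                                           (ℚₚ.∣p*q∣≡∣p∣*∣q∣ yn (xm - xn))))
    (ℚₚ.≤-trans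
      (ℚₚ.+-mono-≤
        (*-mono₂ (ℚₚ.0≤∣p∣ xm) (ℚₚ.<⇒≤ 0<δ)
          (boundX m (le₁ N≤m)) (closeY m n (le₄ N≤m) (le₄ N≤n)))
        (*-mono₂ (ℚₚ.0≤∣p∣ yn) (ℚₚ.<⇒≤ 0<δ)
          (boundY n (le₂ N≤n)) (closeX m n (le₃ N≤m) (le₃ N≤n))))
      (ℚₚ.≤-reflexive (trans
        (solve 4 (λ a b e i → a :* (e :* i) :+ b :* (e :* i) := e :* ((a :+ b) :* i))
          refl Bx By ε (1/ (Bx + By)))
        (trans (cong (ε *_) (ℚₚ.*-inverseʳ (Bx + By))) (ℚₚ.*-identityʳ ε)))))))
    where
    bx = eventualBound x
    by = eventualBound y
    Bx = proj₁ bx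
    By = proj₁ by
    boundX = proj₂ (proj₂ (proj₂ bx))
    boundY = proj₂ (proj₂ (proj₂ by))
    0<B : 0ℚ < Bx + By
    0<B = ℚₚ.<-≤-trans (proj₁ (proj₂ bx)) (p≤p+q (ℚₚ.<⇒≤ (proj₁ (proj₂ by))))
    instance B≢0 : NonZero (Bx + By)
             B≢0 = >-nonZero 0<B
    δ : ℚ
    δ = ε * 1/ (Bx + By)
    0<δ : 0ℚ < δ
    0<δ = 0<* 0<ε (0<1/ 0<B)
    cx = cauchy x 0<δ
    cy = cauchy y 0<δ
    closeX = proj₂ cx
    closeY = proj₂ cy
    N₁ = proj₁ (proj₂ (proj₂ bx))
    N₂ = proj₁ (proj₂ (proj₂ by))
    N₃ = proj₁ cx
    N₄ = proj₁ cy
    N = (N₁ ℕ.⊔ N₂) ℕ.⊔ (N₃ ℕ.⊔ N₄)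
    le₁ : ∀ {m} → N ℕ.≤ m → N₁ ℕ.≤ m
    le₁ h = ℕₚ.m⊔n≤o⇒m≤o N₁ N₂ (ℕₚ.m⊔n≤o⇒m≤o (N₁ ℕ.⊔ N₂) (N₃ ℕ.⊔ N₄) h)
    le₂ : ∀ {m} → N ℕ.≤ m → N₂ ℕ.≤ m
    le₂ h = ℕₚ.m⊔n≤o⇒n≤o N₁ N₂ (ℕₚ.m⊔n≤o⇒m≤o (N₁ ℕ.⊔ N₂) (N₃ ℕ.⊔ N₄) h)
    le₃ : ∀ {m} → N ℕ.≤ m → N₃ ℕ.≤ m
    le₃ h = ℕₚ.m⊔n≤o⇒m≤o N₃ N₄ (ℕₚ.m⊔n≤o⇒n≤o (N₁ ℕ.⊔ N₂) (N₃ ℕ.⊔ N₄) h)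
    le₄ : ∀ {m} → N ℕ.≤ m → N₄ ℕ.≤ m
    le₄ h = ℕₚ.m⊔n≤o⇒n≤o N₃ N₄ (ℕₚ.m⊔n≤o⇒n≤o (N₁ ℕ.⊔ N₂) (N₃ ℕ.⊔ N₄) h)

infixr 8 _^ℝ_
_^ℝ_ : ℝ → ℕ → ℝ
x ^ℝ zero  = fromℕ 1
x ^ℝ suc n = x *ℝ (x ^ℝ n)

-- Capping the sequence below by the bound δ of the positivity proof changes
-- only finitely many terms, and keeps every term invertible.
infix 8 1/ℝ_[_]
1/ℝ_[_] : (x : ℝ) → Positiveℝ x → ℝ
1/ℝ x [ δ , 0<δ , _ ] = mkℝ inv λ {ε} 0<ε →
    let N , c = cauchy x (0<* 0<ε (0<* 0<δ 0<δ)) in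
    N , λ m n N≤m N≤n → close
      (oneSided 0<ε m n (within (c n m N≤n N≤m)))
      (oneSided 0<ε n m (within (c m n N≤m N≤n)))
  where
  open Q hiding (∣_∣)
  open +-*-Solver
  cap : ℕ → ℚ
  cap m = seq x m ⊔ δ
  0<cap : ∀ m → 0ℚ < cap m
  0<cap m = ℚₚ.<-≤-trans 0<δ (ℚₚ.p≤q⊔p (seq x m) δ)
  instance
    cap≢0 : ∀ {m} → NonZero (cap m)
    cap≢0 {m} = >-nonZero (0<cap m)
  inv : ℕ → ℚ
  inv m = 1/ cap m
  0≤inv : ∀ m → 0ℚ ≤ inv m
  0≤inv m = ℚₚ.<⇒≤ (0<1/ (0<cap m))
  δ*inv≤1 : ∀ m → inv m * δ ≤ 1ℚ
  δ*inv≤1 m = ℚₚ.≤-trans (*-mono (0≤inv m) (ℚₚ.p≤q⊔p (seq x m) δ))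
                (ℚₚ.≤-reflexive (ℚₚ.*-inverseˡ (cap m)))
  oneSided : ∀ {ε} → 0ℚ < ε → ∀ m n →
             seq x n ≤ seq x m + ε * (δ * δ) → inv m ≤ inv n + ε
  oneSided {ε} 0<ε m n h = ℚₚ.≤-trans (ℚₚ.≤-reflexive lhs)
      (ℚₚ.≤-trans (*-mono (0≤* (0≤inv m) (0≤inv n)) cap≤)
      (ℚₚ.≤-trans (ℚₚ.≤-reflexive mid)
      (ℚₚ.+-monoʳ-≤ (inv n) (ℚₚ.≤-trans
        (*-mono (ℚₚ.<⇒≤ 0<ε) (*-mono₂ (0≤* (0≤inv m) (ℚₚ.<⇒≤ 0<δ)) (ℚₚ.<⇒≤ (ℚₚ.positive⁻¹ 1ℚ))
          (δ*inv≤1 m) (δ*inv≤1 n)))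
        (ℚₚ.≤-reflexive (trans (cong (ε *_) (ℚₚ.*-identityˡ 1ℚ)) (ℚₚ.*-identityʳ ε)))))))
    where
    0≤η : 0ℚ ≤ ε * (δ * δ)
    0≤η = ℚₚ.<⇒≤ (0<* 0<ε (0<* 0<δ 0<δ))
    cap≤ : cap n ≤ cap m + ε * (δ * δ)
    cap≤ = ℚₚ.⊔-lub
      (ℚₚ.≤-trans h (ℚₚ.+-monoˡ-≤ (ε * (δ * δ)) (ℚₚ.p≤p⊔q (seq x m) δ)))
      (ℚₚ.≤-trans (ℚₚ.p≤q⊔p (seq x m) δ) (p≤p+q 0≤η))
    lhs : inv m ≡ inv m * inv n * cap n
    lhs = sym (trans (ℚₚ.*-assoc (inv m) (inv n) (cap n))
      (trans (cong (inv m *_) (ℚₚ.*-inverseˡ (cap n))) (ℚₚ.*-identityʳ (inv m))))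
    mid : inv m * inv n * (cap m + ε * (δ * δ)) ≡ inv n + ε * ((inv m * δ) * (inv n * δ))
    mid = trans
      (solve 5 (λ i j c e d → i :* j :* (c :+ e :* (d :* d))
                           := j :* (i :* c) :+ e :* ((i :* d) :* (j :* d)))
        refl (inv m) (inv n) (cap m) ε δ)
      (cong (_+ ε * ((inv m * δ) * (inv n * δ)))
        (trans (cong (inv n *_) (ℚₚ.*-inverseˡ (cap m))) (ℚₚ.*-identityʳ (inv n))))

keepIfSquare≤ : ℚ → ℚ → ℚ → ℚ
keepIfSquare≤ q s r = if does (s Q.* s ℚₚ.≤? q) then s else r

-- The largest j/(m+1) with j ≤ k whose square is at most q (or 0).
gridRoot : ℕ → ℚ → ℕ → ℚ
gridRoot m q zero    = 0ℚ
gridRoot m q (suc k) = keepIfSquare≤ q (+ suc k Q./ suc m) (gridRoot m q k)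

-- Large enough that q ≤ (k/(m+1))² for every k > fuel m q.
fuel : ℕ → ℚ → ℕ
fuel m q = suc m ℕ.* suc ℤ.∣ Q.↥ q ∣

-- ⌊√q · (m+1)⌋ / (m+1) for q ≥ 0, and 0 for q < 0.
sqrtApprox : ℕ → ℚ → ℚ
sqrtApprox m q = gridRoot m q (fuel m q)

module Sqrt where
  open Q hiding (∣_∣)
  open +-*-Solver

  keepIfSquare≤-elim : ∀ (R : ℚ → Set) q s r → (s * s ≤ q → R s) → (¬ s * s ≤ q → R r) →
                       R (keepIfSquare≤ q s r)
  keepIfSquare≤-elim R q s r = if-elim (s * s ℚₚ.≤? q)
    where
    if-elim : ∀ {A} (d : Dec A) → (A → R s) → (¬ A → R r) → R (if does d then s else r)
    if-elim (yes a) f g = f a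
    if-elim (no ¬a) f g = g ¬a

  gridRoot-nonNeg : ∀ m q k → 0ℚ ≤ gridRoot m q k
  gridRoot-nonNeg m q zero    = ℚₚ.≤-refl
  gridRoot-nonNeg m q (suc k) =
    keepIfSquare≤-elim (0ℚ ≤_) q (+ suc k / suc m) (gridRoot m q k)
      (λ _ → 0≤/ (suc k) (suc m)) (λ _ → gridRoot-nonNeg m q k)

  gridRoot-lower : ∀ m q k → gridRoot m q k * gridRoot m q k ≤ q ⊔ 0ℚ
  gridRoot-lower m q zero    =
    ℚₚ.≤-trans (ℚₚ.≤-reflexive (ℚₚ.*-zeroˡ 0ℚ)) (ℚₚ.p≤q⊔p q 0ℚ)
  gridRoot-lower m q (suc k) =
    keepIfSquare≤-elim (λ z → z * z ≤ q ⊔ 0ℚ) q (+ suc k / suc m) (gridRoot m q k)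
      (λ s²≤q → ℚₚ.≤-trans s²≤q (ℚₚ.p≤p⊔q q 0ℚ)) (λ _ → gridRoot-lower m q k)

  gridRoot-upper : ∀ m q k → q ≤ (+ suc k / suc m) * (+ suc k / suc m) →
    q ≤ (gridRoot m q k + + 1 / suc m) * (gridRoot m q k + + 1 / suc m)
  gridRoot-upper m q zero h =
    subst (λ z → q ≤ z * z) (sym (ℚₚ.+-identityˡ (+ 1 / suc m))) h
  gridRoot-upper m q (suc k) h =
    keepIfSquare≤-elim (λ z → q ≤ (z + + 1 / suc m) * (z + + 1 / suc m))
      q (+ suc k / suc m) (gridRoot m q k)
      (λ _ → subst (λ z → q ≤ z * z) (/-suc (suc k) m) h)
      (λ s²≰q → gridRoot-upper m q k (ℚₚ.<⇒≤ (ℚₚ.≰⇒> s²≰q)))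

  q≤∣↥q∣ : ∀ q → q ≤ + ℤ.∣ ↥ q ∣ / 1
  q≤∣↥q∣ q@(mkℚ (+ n) d _) = ℚₚ.≤-trans (ℚₚ.≤-reflexive (sym (ℚₚ.↥p/↧p≡p q)))
    (/-mono {n} {suc d} {n} {1} (ℕₚ.*-monoʳ-≤ n (ℕ.s≤s ℕ.z≤n)))
  q≤∣↥q∣ q@(mkℚ -[1+ n ] d _) =
    ℚₚ.≤-trans (ℚₚ.<⇒≤ (ℚₚ.negative⁻¹ q)) (0≤/ (suc n) 1)

  fuel-suffices : ∀ m q → let t = + suc (fuel m q) / suc m in q ≤ t * t
  fuel-suffices m q = ℚₚ.≤-trans q≤t
    (subst (_≤ t * t) (ℚₚ.*-identityʳ t) (*-mono (0≤/ (suc K) (suc m)) 1≤t))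
    where
    a = ℤ.∣ ↥ q ∣
    K = fuel m q
    t = + suc K / suc m
    1≤t : 1ℚ ≤ t
    1≤t = /-mono {1} {1} {suc K} {suc m} (subst₂ ℕ._≤_
      (sym (ℕₚ.*-identityˡ (suc m))) (sym (ℕₚ.*-identityʳ (suc K)))
      (ℕₚ.m≤n⇒m≤1+n (ℕₚ.m≤m*n (suc m) (suc a))))
    q≤t : q ≤ t
    q≤t = ℚₚ.≤-trans (q≤∣↥q∣ q) (/-mono {a} {1} {suc K} {suc m}
      (subst₂ ℕ._≤_ (ℕₚ.*-comm (suc m) a) (sym (ℕₚ.*-identityʳ (suc K)))
      (ℕₚ.m≤n⇒m≤1+n (ℕₚ.*-monoʳ-≤ (suc m) (ℕₚ.n≤1+n a)))))

  module _ (x : ℝ) where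
    s : ℕ → ℚ
    s m = sqrtApprox m (seq x m)

    0≤s : ∀ m → 0ℚ ≤ s m
    0≤s m = gridRoot-nonNeg m (seq x m) (fuel m (seq x m))

    h : ℕ → ℚ
    h m = + 1 / suc m

    upper : ∀ m → seq x m ≤ (s m + h m) * (s m + h m)
    upper m = gridRoot-upper m (seq x m) (fuel m (seq x m)) (fuel-suffices m (seq x m))

    oneSided : ∀ {η} → 0ℚ < η → ∀ m n → h m ≤ η →
               seq x n ≤ seq x m + η * η → s n ≤ s m + (η + η)
    oneSided {η} 0<η m n h≤η xn≤ = square-cancel 0≤R (ℚₚ.≤-trans
        (gridRoot-lower n (seq x n) (fuel n (seq x n))) (ℚₚ.⊔-lub xn≤R² (0≤* 0≤R 0≤R)))
      where
      0≤η = ℚₚ.<⇒≤ 0<η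
      R = s m + (η + η)
      0≤R : 0ℚ ≤ R
      0≤R = ℚₚ.≤-trans (0≤s m) (p≤p+q (ℚₚ.≤-trans 0≤η (p≤p+q 0≤η)))
      0≤sm+h : 0ℚ ≤ s m + h m
      0≤sm+h = ℚₚ.≤-trans (0≤s m) (p≤p+q (0≤/ 1 (suc m)))
      sm+h≤ : s m + h m ≤ s m + η
      sm+h≤ = ℚₚ.+-monoʳ-≤ (s m) h≤η
      xn≤R² : seq x n ≤ R * R
      xn≤R² = ℚₚ.≤-trans xn≤
        (ℚₚ.≤-trans (ℚₚ.+-monoˡ-≤ (η * η) (ℚₚ.≤-trans (upper m)
          (*-mono₂ 0≤sm+h (ℚₚ.≤-trans 0≤sm+h sm+h≤) sm+h≤ sm+h≤)))
        (ℚₚ.≤-trans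
          (p≤p+q (0≤* 0≤η (0≤R)))
          (ℚₚ.≤-trans (p≤p+q (0≤* 0≤η (0≤s m))) (ℚₚ.≤-reflexive
            (solve 2 (λ a e → (a :+ e) :* (a :+ e) :+ e :* e :+ e :* (a :+ (e :+ e)) :+ e :* a
                           := (a :+ (e :+ e)) :* (a :+ (e :+ e)))
               refl (s m) η)))))

-- For x ≥ 0 this is the non-negative square root; for x ≤ 0 it is 0.
√ : ℝ → ℝ
√ x = mkℝ (λ m → sqrtApprox m (seq x m)) √-cauchy
  where
  open Q hiding (∣_∣)
  √-cauchy : ∀ {ε} → 0ℚ < ε → ∃[ N ] ∀ m n → N ℕ.≤ m → N ℕ.≤ n →
             ∣ sqrtApprox m (seq x m) - sqrtApprox n (seq x n) ∣ ≤ ε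
  √-cauchy {ε} 0<ε = N , λ m n N≤m N≤n → close (bound n m N≤n N≤m) (bound m n N≤m N≤n)
    where
    η = ε * ½
    0<η = 0<* 0<ε 0<½
    c = cauchy x (0<* 0<η 0<η)
    a = archimedean 0<η
    N = proj₁ c ℕ.⊔ proj₁ a
    bound : ∀ m n → N ℕ.≤ m → N ℕ.≤ n →
            sqrtApprox n (seq x n) ≤ sqrtApprox m (seq x m) + ε
    bound m n N≤m N≤n = subst (λ e → sqrtApprox n (seq x n) ≤ sqrtApprox m (seq x m) + e)
      (ε/2+ε/2 ε)
      (Sqrt.oneSided x 0<η m n (proj₂ a m (ℕₚ.m⊔n≤o⇒n≤o (proj₁ c) (proj₁ a) N≤m))
        (within (proj₂ c n m (ℕₚ.m⊔n≤o⇒m≤o (proj₁ c) (proj₁ a) N≤n)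
                             (ℕₚ.m⊔n≤o⇒m≤o (proj₁ c) (proj₁ a) N≤m))))

partialSum : (ℕ → ℚ) → ℕ → ℚ
partialSum f zero    = f 0
partialSum f (suc n) = partialSum f n Q.+ f (suc n)

expTerm : ℕ → ℚ
expTerm k = (+ 1 Q./ k !) {{k !≢0}}

sign : ℕ → ℚ
sign zero    = 1ℚ
sign (suc k) = Q.- sign k

leibnizTerm : ℕ → ℚ
leibnizTerm k = sign k Q.* (+ 1 Q./ suc (2 ℕ.* k))

module Series where
  open Q hiding (∣_∣)
  open +-*-Solver

  cauchyFromTail : (x : ℕ → ℚ) →
    (∀ m j → ∣ x (suc m ℕ.+ j) - x (suc m) ∣ ≤ + 1 / suc m) →
    ∀ {ε} → 0ℚ < ε → ∃[ N ] ∀ m n → N ℕ.≤ m → N ℕ.≤ n → ∣ x m - x n ∣ ≤ ε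
  cauchyFromTail x tail {ε} 0<ε = suc N , λ m n N<m N<n → close (bound m n N<m N<n) (bound n m N<n N<m)
    where
    a = archimedean (0<* 0<ε 0<½)
    N = proj₁ a
    near : ∀ m → suc N ℕ.≤ m → ∣ x m - x (suc N) ∣ ≤ ε * ½
    near m N<m = ℚₚ.≤-trans
      (subst (λ k → ∣ x k - x (suc N) ∣ ≤ + 1 / suc N) (ℕₚ.m+[n∸m]≡n N<m)
        (tail N (m ℕ.∸ suc N)))
      (proj₂ a N ℕₚ.≤-refl)
    bound : ∀ m n → suc N ℕ.≤ m → suc N ℕ.≤ n → x m ≤ x n + ε
    bound m n N<m N<n = ℚₚ.≤-trans (within (near m N<m))
      (ℚₚ.≤-trans (ℚₚ.+-monoˡ-≤ (ε * ½) (within {x (suc N)} {x n}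
          (subst (_≤ ε * ½) (flip-sub (x n) (x (suc N))) (near n N<n))))
        (ℚₚ.≤-reflexive (trans (ℚₚ.+-assoc (x n) (ε * ½) (ε * ½))
                               (cong (λ z → x n + z) (ε/2+ε/2 ε)))))

  0≤expTerm : ∀ k → 0ℚ ≤ expTerm k
  0≤expTerm k = 0≤/ 1 (k !) {{k !≢0}}

  n≤n! : ∀ n → n ℕ.≤ n !
  n≤n! zero    = ℕ.z≤n
  n≤n! (suc n) = ℕₚ.m≤m*n (suc n) (n !) {{n !≢0}}

  expTerm-telescope : ∀ b → expTerm (suc (suc b)) + + 1 / suc (suc b) ≤ + 1 / suc b
  expTerm-telescope b = /-+-≤ {1} {F} {1} {suc a} {1} {a} {{suc a !≢0}} nat
    where
    a = suc b
    F = suc a !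
    nat : (1 ℕ.* suc a ℕ.+ 1 ℕ.* F) ℕ.* a ℕ.≤ 1 ℕ.* (F ℕ.* suc a)
    nat = begin
      (1 ℕ.* suc a ℕ.+ 1 ℕ.* F) ℕ.* a
        ≡⟨ cong₂ (λ u v → (u ℕ.+ v) ℕ.* a) (ℕₚ.*-identityˡ (suc a)) (ℕₚ.*-identityˡ F) ⟩
      (suc a ℕ.+ F) ℕ.* a       ≡⟨ ℕₚ.*-distribʳ-+ a (suc a) F ⟩
      suc a ℕ.* a ℕ.+ F ℕ.* a   ≤⟨ ℕₚ.+-monoˡ-≤ (F ℕ.* a) (ℕₚ.*-monoʳ-≤ (suc a) (n≤n! a)) ⟩
      F ℕ.+ F ℕ.* a             ≡⟨ sym (ℕₚ.*-suc F a) ⟩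
      F ℕ.* suc a               ≡⟨ sym (ℕₚ.*-identityˡ (F ℕ.* suc a)) ⟩
      1 ℕ.* (F ℕ.* suc a)       ∎
      where open ℕₚ.≤-Reasoning

  expSum : ℕ → ℚ
  expSum = partialSum expTerm

  expSum-mono : ∀ m j → expSum m ≤ expSum (m ℕ.+ j)
  expSum-mono m zero    = ℚₚ.≤-reflexive (cong expSum (sym (ℕₚ.+-identityʳ m)))
  expSum-mono m (suc j) = subst (λ k → expSum m ≤ expSum k) (sym (ℕₚ.+-suc m j))
    (ℚₚ.≤-trans (expSum-mono m j) (p≤p+q (0≤expTerm (suc (m ℕ.+ j)))))

  expSum-decr : ∀ m j → expSum (suc m ℕ.+ j) + + 1 / (suc (m ℕ.+ j)) ≤ expSum (suc m) + + 1 / suc m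
  expSum-decr m zero rewrite ℕₚ.+-identityʳ m = ℚₚ.≤-refl
  expSum-decr m (suc j) rewrite ℕₚ.+-suc m j = ℚₚ.≤-trans
    (ℚₚ.≤-trans
      (ℚₚ.≤-reflexive (ℚₚ.+-assoc (expSum (suc (m ℕ.+ j))) _ _))
      (ℚₚ.+-monoʳ-≤ (expSum (suc (m ℕ.+ j))) (expTerm-telescope (m ℕ.+ j))))
    (expSum-decr m j)

  expSum-tail : ∀ m j → ∣ expSum (suc m ℕ.+ j) - expSum (suc m) ∣ ≤ + 1 / suc m
  expSum-tail m j = close {expSum (suc m ℕ.+ j)} {expSum (suc m)}
    (ℚₚ.≤-trans (p≤p+q (0≤/ 1 (suc (m ℕ.+ j)))) (expSum-decr m j))
    (ℚₚ.≤-trans (expSum-mono (suc m) j) (p≤p+q (0≤/ 1 (suc m))))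

  u : ℕ → ℚ
  u k = + 1 / suc (2 ℕ.* k)

  u-decr : ∀ k → u (suc k) ≤ u k
  u-decr k = /-mono {1} {suc (2 ℕ.* suc k)} {1} {suc (2 ℕ.* k)} (ℕₚ.*-monoʳ-≤ 1
    (ℕ.s≤s (ℕₚ.*-monoʳ-≤ 2 (ℕₚ.n≤1+n k))))

  -- u m − u (m+1) + u (m+2) − …  (j terms)
  alternating : ℕ → ℕ → ℚ
  alternating m zero    = 0ℚ
  alternating m (suc j) = u m - alternating (suc m) j

  alternating-bounds : ∀ m j → 0ℚ ≤ alternating m j × alternating m j ≤ u m
  alternating-bounds m zero    = ℚₚ.≤-refl , 0≤/ 1 (suc (2 ℕ.* m))
  alternating-bounds m (suc j) with alternating-bounds (suc m) j
  ... | 0≤A , A≤u =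
      ℚₚ.≤-trans (ℚₚ.≤-reflexive (sym (ℚₚ.+-inverseʳ A)))
        (ℚₚ.+-monoˡ-≤ (- A) (ℚₚ.≤-trans A≤u (u-decr m)))
    , p≤q+ε⇒p-q≤ε (subst (u m ≤_) (ℚₚ.+-comm (u m) A) (p≤p+q 0≤A))
    where A = alternating (suc m) j

  ∣sign∣ : ∀ k → ∣ sign k ∣ ≡ 1ℚ
  ∣sign∣ zero    = refl
  ∣sign∣ (suc k) = trans (ℚₚ.∣-p∣≡∣p∣ (sign k)) (∣sign∣ k)

  leibnizSum : ℕ → ℚ
  leibnizSum = partialSum leibnizTerm

  leibnizSum-tail : ∀ m j →
    leibnizSum (m ℕ.+ j) - leibnizSum m ≡ sign (suc m) * alternating (suc m) j
  leibnizSum-tail m zero = trans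
    (trans (cong (λ k → leibnizSum k - leibnizSum m) (ℕₚ.+-identityʳ m))
           (ℚₚ.+-inverseʳ (leibnizSum m)))
    (sym (ℚₚ.*-zeroʳ (sign (suc m))))
  leibnizSum-tail m (suc j) = trans
    (cong (λ k → leibnizSum k - leibnizSum m) (ℕₚ.+-suc m j))
    (trans (solve 3 (λ a b c → a :- b := (a :- (b :+ c)) :+ c) refl
             (leibnizSum (suc m ℕ.+ j)) (leibnizSum m) (leibnizTerm (suc m)))
    (trans (cong (_+ leibnizTerm (suc m)) (leibnizSum-tail (suc m) j))
           (solve 3 (λ σ a b → (:- σ) :* b :+ σ :* a := σ :* (a :- b)) refl
             (sign (suc m)) (u (suc m)) (alternating (suc (suc m)) j))))

  leibnizSum-close : ∀ m j → ∣ leibnizSum (suc m ℕ.+ j) - leibnizSum (suc m) ∣ ≤ + 1 / suc m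
  leibnizSum-close m j = ℚₚ.≤-trans (ℚₚ.≤-reflexive (trans
      (cong ∣_∣ (leibnizSum-tail (suc m) j))
      (trans (ℚₚ.∣p*q∣≡∣p∣*∣q∣ (sign (suc (suc m))) A)
      (trans (cong₂ _*_ (∣sign∣ (suc (suc m))) (ℚₚ.0≤p⇒∣p∣≡p (proj₁ bounds)))
             (ℚₚ.*-identityˡ A)))))
    (ℚₚ.≤-trans (proj₂ bounds) (/-mono {1} {suc (2 ℕ.* suc (suc m))} {1} {suc m}
      (ℕₚ.*-monoʳ-≤ 1 (ℕ.s≤s (ℕₚ.≤-trans (ℕₚ.m≤n+m m 2) (ℕₚ.m≤m+n (suc (suc m)) _))))))
    where
    A = alternating (suc (suc m)) j
    bounds = alternating-bounds (suc (suc m)) j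

-- e = Σ 1/k!
e : ℝ
e = mkℝ (partialSum expTerm) (Series.cauchyFromTail (partialSum expTerm) Series.expSum-tail)

-- π = 4 (1 - 1/3 + 1/5 - 1/7 + …)
π : ℝ
π = fromℕ 4 *ℝ mkℝ (partialSum leibnizTerm)
                   (Series.cauchyFromTail (partialSum leibnizTerm) Series.leibnizSum-close)

infix 4 _∈Ω_
_∈Ω_ : (ℕ → ℝ) → (ℕ → ℝ) → Set
f ∈Ω g = ∃[ c ] Positiveℝ c × ∃[ n₀ ] ∀ n → n₀ ℕ.≤ n → c *ℝ g n ≤ℝ f n

fromℕ-positive : ∀ n .{{_ : ℕ.NonZero n}} → Positiveℝ (fromℕ n)
fromℕ-positive n@(suc _) = 1ℚ , ℚₚ.positive⁻¹ 1ℚ , 0 , λ _ _ →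
  /-mono {1} {1} {n} {1} (ℕₚ.*-monoˡ-≤ 1 {1} {n} (ℕ.s≤s ℕ.z≤n))

*ℝ-positive : ∀ x y → Positiveℝ x → Positiveℝ y → Positiveℝ (x *ℝ y)
*ℝ-positive x y (δ , 0<δ , M , hx) (δ′ , 0<δ′ , N , hy) =
  δ Q.* δ′ , 0<* 0<δ 0<δ′ , M ℕ.⊔ N , λ m le →
    let δ′≤y = hy m (ℕₚ.m⊔n≤o⇒n≤o M N le) in
    *-mono₂ (ℚₚ.<⇒≤ 0<δ) (ℚₚ.≤-trans (ℚₚ.<⇒≤ 0<δ′) δ′≤y)
      (hx m (ℕₚ.m⊔n≤o⇒m≤o M N le)) δ′≤y

e-positive : Positiveℝ e
e-positive = 1ℚ , ℚₚ.positive⁻¹ 1ℚ , 0 , λ m _ → Series.expSum-mono 0 m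

^ℝ-positive : ∀ x → Positiveℝ x → ∀ n → Positiveℝ (x ^ℝ n)
^ℝ-positive x p zero    = fromℕ-positive 1
^ℝ-positive x p (suc n) = *ℝ-positive x (x ^ℝ n) p (^ℝ-positive x p n)

module Growth (Δ γ n : ℕ) where

  -- n^(Δn+Δ+3/2) is written n^(Δn+Δ+1) · √n.
  numerator : ℝ
  numerator = √ (fromℕ 2 *ℝ π) *ℝ
              (fromℕ (n ℕ.^ (Δ ℕ.* n ℕ.+ Δ ℕ.+ 1)) *ℝ √ (fromℕ n))

  F₁ F₂ : ℕ
  F₁ = ((Δ ℕ.∸ 1) ℕ.* n ℕ.+ Δ ℕ.+ 1) !
  F₂ = (n ℕ.+ 1) !

  denominator : ℝ
  denominator = (e ^ℝ n) *ℝ (fromℕ F₁ *ℝ fromℕ F₂)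

  denominator-positive : Positiveℝ denominator
  denominator-positive =
    *ℝ-positive (e ^ℝ n) (fromℕ F₁ *ℝ fromℕ F₂) (^ℝ-positive e e-positive n)
      (*ℝ-positive (fromℕ F₁) (fromℕ F₂)
        (fromℕ-positive F₁ {{((Δ ℕ.∸ 1) ℕ.* n ℕ.+ Δ ℕ.+ 1) !≢0}})
        (fromℕ-positive F₂ {{(n ℕ.+ 1) !≢0}}))

  growth : ℝ
  growth = numerator *ℝ 1/ℝ denominator [ denominator-positive ] *ℝ fromℕ γ

open Growth public using (growth)

{-# OPTIONS --safe #-}
module Submission where

-- A sweep-cover with m + 1 subcovers is read off a word of m letters by
-- descending from one Δ-star node to the next: every letter covers all but one
-- child of the current star node by a single subcover and continues below the
-- omitted child, and the star node reached at the end is covered by itself.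
-- Three letters are available (the omitted child if Δ ≥ 3, and for Δ = 2 also
-- the variant that needs γ ≥ 1 and covers the child of the other child), so
-- P(m + 1) ≥ 3^m.  Conversely, n^M ≤ eⁿ M! for all M ≥ n, applied with M = n
-- and with M = (Δ-1)n + Δ + 1, bounds the growth function by 3 eⁿ γ ≤ 3 · 3ⁿ γ.
-- The inequality at M = n follows from (1 + 1/n)ⁿ ≤ e, and larger M only add
-- factors n ≤ M + 1.

open import Defs
import Data.Integer.Base as ℤ
open import Data.Nat.Base as ℕ using (ℕ; zero; suc; _!)
import Data.Nat.Properties as ℕₚ
open ℕₚ using (_!≢0)
open import Data.Nat.Solver using () renaming (module +-*-Solver to ℕSolver)
open import Data.Product.Base using (∃-syntax; _×_; _,_; proj₁; proj₂; uncurry)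
open import Data.Rational as Q using (ℚ; 0ℚ)
import Data.Rational.Properties as ℚₚ
open import Data.Rational.Solver using (module +-*-Solver)
open import Relation.Binary.PropositionalEquality

-- Naturals inside the rationals, powers and reciprocal factorials.

module Numeric where
  open Q using (1ℚ; _+_; _*_; _/_; _≤_; 1/_)
  open Lemmas
  open Series using (expSum; 0≤expTerm)
  open +-*-Solver

  ι : ℕ → ℚ
  ι n = ℤ.+ n / 1

  ι-mono : ∀ {a b} → a ℕ.≤ b → ι a ≤ ι b
  ι-mono {a} {b} a≤b = /-mono {a} {1} {b} {1} (ℕₚ.*-monoˡ-≤ 1 a≤b)

  0≤ι : ∀ n → 0ℚ ≤ ι n
  0≤ι n = 0≤/ n 1

  ι-+ : ∀ a b → ι (a ℕ.+ b) ≡ ι a + ι b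
  ι-+ zero    b = sym (ℚₚ.+-identityˡ (ι b))
  ι-+ (suc a) b = begin
    ι (suc (a ℕ.+ b)) ≡⟨ /-suc (a ℕ.+ b) 0 ⟩
    ι (a ℕ.+ b) + 1ℚ  ≡⟨ cong (_+ 1ℚ) (ι-+ a b) ⟩
    (ι a + ι b) + 1ℚ  ≡⟨ solve 3 (λ x y z → (x :+ y) :+ z := (x :+ z) :+ y) refl (ι a) (ι b) 1ℚ ⟩
    (ι a + 1ℚ) + ι b  ≡⟨ cong (_+ ι b) (/-suc a 0) ⟨
    ι (suc a) + ι b   ∎
    where open ≡-Reasoning

  ι-* : ∀ a b → ι (a ℕ.* b) ≡ ι a * ι b
  ι-* zero    b = sym (ℚₚ.*-zeroˡ (ι b))
  ι-* (suc a) b = begin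
    ι (b ℕ.+ a ℕ.* b)  ≡⟨ ι-+ b (a ℕ.* b) ⟩
    ι b + ι (a ℕ.* b)  ≡⟨ cong (ι b +_) (ι-* a b) ⟩
    ι b + ι a * ι b    ≡⟨ cong (_+ ι a * ι b) (ℚₚ.*-identityˡ (ι b)) ⟨
    1ℚ * ι b + ι a * ι b
      ≡⟨ solve 3 (λ x y o → o :* y :+ x :* y := (x :+ o) :* y) refl (ι a) (ι b) 1ℚ ⟩
    (ι a + 1ℚ) * ι b   ≡⟨ cong (_* ι b) (/-suc a 0) ⟨
    ι (suc a) * ι b    ∎
    where open ≡-Reasoning

  -- `_/_` reduces to lowest terms and does not compute on a variable, so the product is found by
  -- induction on a numerator `k` over the fixed denominator.
  ι*1/ : ∀ b .{{_ : ℕ.NonZero b}} → ι b * (ℤ.+ 1 / b) ≡ 1ℚ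
  ι*1/ (suc b) = trans (go (suc b)) (ι/ b)
    where
    go : ∀ k → ι k * (ℤ.+ 1 / suc b) ≡ ℤ.+ k / suc b
    go zero    = trans (ℚₚ.*-zeroˡ (ℤ.+ 1 / suc b))
      (ℚₚ.≤-antisym (0≤/ 0 (suc b)) (/-mono {0} {suc b} {0} {1} ℕ.z≤n))
    go (suc k) = begin
      ι (suc k) * (ℤ.+ 1 / suc b)            ≡⟨ cong (_* (ℤ.+ 1 / suc b)) (/-suc k 0) ⟩
      (ι k + 1ℚ) * (ℤ.+ 1 / suc b)           ≡⟨ ℚₚ.*-distribʳ-+ (ℤ.+ 1 / suc b) (ι k) 1ℚ ⟩
      ι k * (ℤ.+ 1 / suc b) + 1ℚ * (ℤ.+ 1 / suc b)
        ≡⟨ cong₂ _+_ (go k) (ℚₚ.*-identityˡ (ℤ.+ 1 / suc b)) ⟩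
      ℤ.+ k / suc b + ℤ.+ 1 / suc b            ≡⟨ /-suc k b ⟨
      ℤ.+ suc k / suc b                      ∎
      where open ≡-Reasoning
    ι/ : ∀ b → ℤ.+ suc b / suc b ≡ 1ℚ
    ι/ b = ℚₚ.≤-antisym
      (/-mono {suc b} {suc b} {1} {1} (ℕₚ.≤-reflexive (ℕₚ.*-comm (suc b) 1)))
      (/-mono {1} {1} {suc b} {suc b} (ℕₚ.≤-reflexive (ℕₚ.*-comm 1 (suc b))))

  infixr 8 _^_
  _^_ : ℚ → ℕ → ℚ
  q ^ zero  = 1ℚ
  q ^ suc n = q * q ^ n

  0≤1 : 0ℚ ≤ 1ℚ
  0≤1 = 0≤ι 1

  ^-nonNeg : ∀ {q} → 0ℚ ≤ q → ∀ n → 0ℚ ≤ q ^ n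
  ^-nonNeg 0≤q zero    = 0≤1
  ^-nonNeg 0≤q (suc n) = 0≤* 0≤q (^-nonNeg 0≤q n)

  ^-mono : ∀ {p q} → 0ℚ ≤ p → p ≤ q → ∀ n → p ^ n ≤ q ^ n
  ^-mono 0≤p p≤q zero    = ℚₚ.≤-refl
  ^-mono 0≤p p≤q (suc n) =
    *-mono₂ 0≤p (^-nonNeg (ℚₚ.≤-trans 0≤p p≤q) n) p≤q (^-mono 0≤p p≤q n)

  1^ : ∀ n → 1ℚ ^ n ≡ 1ℚ
  1^ zero    = refl
  1^ (suc n) = trans (ℚₚ.*-identityˡ (1ℚ ^ n)) (1^ n)

  ι-^ : ∀ a n → ι (a ℕ.^ n) ≡ ι a ^ n
  ι-^ a zero    = refl
  ι-^ a (suc n) = trans (ι-* a (a ℕ.^ n)) (cong (ι a *_) (ι-^ a n))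

  expTerm-suc : ∀ j → ι (suc j) * expTerm (suc j) ≡ expTerm j
  expTerm-suc j = begin
    ι (suc j) * E′                     ≡⟨ ℚₚ.*-identityˡ (ι (suc j) * E′) ⟨
    1ℚ * (ι (suc j) * E′)              ≡⟨ cong (_* (ι (suc j) * E′)) (ι*1/ (j !) {{j !≢0}}) ⟨
    (ι (j !) * E) * (ι (suc j) * E′)
      ≡⟨ solve 4 (λ a b c d → (a :* b) :* (c :* d) := b :* ((c :* a) :* d)) refl (ι (j !)) E (ι (suc j)) E′ ⟩
    E * ((ι (suc j) * ι (j !)) * E′)   ≡⟨ cong (λ z → E * (z * E′)) (ι-* (suc j) (j !)) ⟨
    E * (ι (suc j !) * E′)             ≡⟨ cong (E *_) (ι*1/ (suc j !) {{suc j !≢0}}) ⟩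
    E * 1ℚ                             ≡⟨ ℚₚ.*-identityʳ E ⟩
    E                                  ∎
    where
    open ≡-Reasoning
    E = expTerm j
    E′ = expTerm (suc j)

  -- Truncated exponential series.

  expTaylor : ℚ → ℕ → ℚ
  expTaylor a = partialSum (λ j → a ^ j * expTerm j)

  module _ {a x : ℚ} (0≤a : 0ℚ ≤ a) (0≤x : 0ℚ ≤ x) where
    open ℚₚ.≤-Reasoning

    0≤a+x : 0ℚ ≤ a + x
    0≤a+x = ℚₚ.≤-trans 0≤a (p≤p+q 0≤x)

    -- The first two terms of the binomial expansion; the omitted ones are non-negative. The
    -- homogeneous form avoids dividing by `a`, which may be 0.
    bernoulli : ∀ j → a ^ suc j + ι (suc j) * (x * a ^ j) ≤ (a + x) ^ suc j
    bernoulli zero    = ℚₚ.≤-reflexive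
      (solve 2 (λ a x → a :* con 1ℚ :+ con 1ℚ :* (x :* con 1ℚ) := (a :+ x) :* con 1ℚ) refl a x)
    bernoulli (suc j) = begin
      a * (a * a ^ j) + ι (suc (suc j)) * (x * (a * a ^ j))
        ≡⟨ cong (λ z → a * (a * a ^ j) + z * (x * (a * a ^ j))) (/-suc (suc j) 0) ⟩
      a * (a * a ^ j) + (ι (suc j) + 1ℚ) * (x * (a * a ^ j))
        -- The added term in `x * x` completes the expression to `a + x` times the left side of the
        -- induction hypothesis.
        ≤⟨ p≤p+q (0≤* (0≤ι (suc j)) (0≤* (0≤* 0≤x 0≤x) (^-nonNeg 0≤a j))) ⟩
      a * (a * a ^ j) + (ι (suc j) + 1ℚ) * (x * (a * a ^ j)) + ι (suc j) * ((x * x) * a ^ j)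
        ≡⟨ cong (λ z → a * (a * a ^ j) + z + ι (suc j) * ((x * x) * a ^ j))
             (trans (ℚₚ.*-distribʳ-+ (x * (a * a ^ j)) (ι (suc j)) 1ℚ)
               (cong (λ z → ι (suc j) * (x * (a * a ^ j)) + z) (ℚₚ.*-identityˡ _))) ⟩
      a * (a * a ^ j) + (ι (suc j) * (x * (a * a ^ j)) + x * (a * a ^ j)) + ι (suc j) * ((x * x) * a ^ j)
        ≡⟨ solve 4 (λ a x n p → a :* (a :* p) :+ (n :* (x :* (a :* p)) :+ x :* (a :* p)) :+ n :* ((x :* x) :* p)
                             := (a :+ x) :* (a :* p :+ n :* (x :* p))) refl a x (ι (suc j)) (a ^ j) ⟩
      (a + x) * (a ^ suc j + ι (suc j) * (x * a ^ j))
        ≤⟨ *-mono 0≤a+x (bernoulli j) ⟩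
      (a + x) ^ suc (suc j) ∎

    -- Bernoulli's inequality divided by (j+1)!, with 1/j! written as (j+1)/(j+1)!.
    expTaylor-term : ∀ j → a ^ suc j * expTerm (suc j) + x * (a ^ j * expTerm j)
                         ≤ (a + x) ^ suc j * expTerm (suc j)
    expTaylor-term j = begin
      a ^ suc j * E′ + x * (a ^ j * expTerm j)
        ≡⟨ cong (λ z → a ^ suc j * E′ + x * (a ^ j * z)) (expTerm-suc j) ⟨
      a ^ suc j * E′ + x * (a ^ j * (ι (suc j) * E′))
        ≡⟨ solve 5 (λ a x p n e → a :* e :+ x :* (p :* (n :* e)) := e :* (a :+ n :* (x :* p)))
             refl (a ^ suc j) x (a ^ j) (ι (suc j)) E′ ⟩
      E′ * (a ^ suc j + ι (suc j) * (x * a ^ j))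
        ≤⟨ *-mono (0≤expTerm (suc j)) (bernoulli j) ⟩
      E′ * (a + x) ^ suc j ≡⟨ ℚₚ.*-comm E′ _ ⟩
      (a + x) ^ suc j * E′ ∎
      where E′ = expTerm (suc j)

    -- Sums `expTaylor-term` over j ≤ K; the constant terms agree. Each term of degree j that is
    -- multiplied by `x` is charged to degree j+1, hence the different truncations.
    expTaylor-shift : ∀ K → expTaylor a (suc K) + x * expTaylor a K ≤ expTaylor (a + x) (suc K)
    expTaylor-shift zero = begin
      (t₀ + t 1) + x * t₀ ≡⟨ ℚₚ.+-assoc t₀ (t 1) (x * t₀) ⟩
      t₀ + (t 1 + x * t₀) ≤⟨ ℚₚ.+-monoʳ-≤ t₀ (expTaylor-term 0) ⟩
      expTaylor (a + x) 1 ∎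
      where
      t : ℕ → ℚ
      t j = a ^ j * expTerm j
      t₀ = t 0
    expTaylor-shift (suc K) = begin
      (S′ + t″) + x * (S + t′)
        ≡⟨ solve 5 (λ S′ S t″ t′ x → (S′ :+ t″) :+ x :* (S :+ t′) := (S′ :+ x :* S) :+ (t″ :+ x :* t′))
             refl S′ S t″ t′ x ⟩
      (S′ + x * S) + (t″ + x * t′)
        ≤⟨ ℚₚ.+-mono-≤ (expTaylor-shift K) (expTaylor-term (suc K)) ⟩
      expTaylor (a + x) (suc (suc K)) ∎
      where
      S = expTaylor a K
      S′ = expTaylor a (suc K)
      t′ = a ^ suc K * expTerm (suc K)
      t″ = a ^ suc (suc K) * expTerm (suc (suc K))

    -- A truncated form of (1 + x) eᵃ ≤ e^(a + x). The degree rises by one per step, so k steps from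
    -- degree 0 end at degree k.
    expTaylor-step : ∀ K → (1ℚ + x) * expTaylor a K ≤ expTaylor (a + x) (suc K)
    expTaylor-step K = begin
      (1ℚ + x) * expTaylor a K                ≡⟨ ℚₚ.*-distribʳ-+ (expTaylor a K) 1ℚ x ⟩
      1ℚ * expTaylor a K + x * expTaylor a K
        ≡⟨ cong (_+ x * expTaylor a K) (ℚₚ.*-identityˡ (expTaylor a K)) ⟩
      expTaylor a K + x * expTaylor a K
        ≤⟨ ℚₚ.+-monoˡ-≤ (x * expTaylor a K)
             (p≤p+q {expTaylor a K} (0≤* (^-nonNeg 0≤a (suc K)) (0≤expTerm (suc K)))) ⟩
      expTaylor a (suc K) + x * expTaylor a K ≤⟨ expTaylor-shift K ⟩
      expTaylor (a + x) (suc K)               ∎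

  -- Since (1 + x) T(a) ≤ T(a + x) for the truncated exponentials T, starting at
  -- a = 0 gives (1 + x)^k ≤ T(k x); both sides are multiplied by (1/x)^k.
  suc-power : ∀ {x y} → 0ℚ ≤ x → 0ℚ ≤ y → x * y ≡ 1ℚ →
              ∀ k → (y + 1ℚ) ^ k ≤ y ^ k * expTaylor (ι k * x) k
  suc-power {x} {y} 0≤x 0≤y xy≡1 zero    = ℚₚ.≤-refl
  suc-power {x} {y} 0≤x 0≤y xy≡1 (suc k) = begin
    (y + 1ℚ) * (y + 1ℚ) ^ k      ≤⟨ *-mono (ℚₚ.≤-trans 0≤y (p≤p+q 0≤1)) (suc-power 0≤x 0≤y xy≡1 k) ⟩
    (y + 1ℚ) * (y ^ k * S)       ≡⟨ cong (λ z → (y + z) * (y ^ k * S)) xy≡1 ⟨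
    (y + x * y) * (y ^ k * S)
      ≡⟨ cong (λ z → (z + x * y) * (y ^ k * S)) (ℚₚ.*-identityˡ y) ⟨
    (1ℚ * y + x * y) * (y ^ k * S)
      ≡⟨ solve 5 (λ x y p t o → (o :* y :+ x :* y) :* (p :* t) := y :* p :* ((o :+ x) :* t))
           refl x y (y ^ k) S 1ℚ ⟩
    y ^ suc k * ((1ℚ + x) * S)
      ≤⟨ *-mono (^-nonNeg 0≤y (suc k)) (expTaylor-step (0≤* (0≤ι k) 0≤x) 0≤x k) ⟩
    y ^ suc k * expTaylor (ι k * x + x) (suc k)
      ≡⟨ cong (λ z → y ^ suc k * expTaylor z (suc k)) kx+x ⟩
    y ^ suc k * expTaylor (ι (suc k) * x) (suc k) ∎
    where
    open ℚₚ.≤-Reasoning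
    S = expTaylor (ι k * x) k
    kx+x : ι k * x + x ≡ ι (suc k) * x
    kx+x = trans (cong (_+_ (ι k * x)) (sym (ℚₚ.*-identityˡ x)))
      (trans (sym (ℚₚ.*-distribʳ-+ x (ι k) 1ℚ)) (cong (_* x) (sym (/-suc k 0))))

  -- Partial sums of e and the inequality nⁿ ≤ eⁿ n!.

  expTaylor-1 : ∀ K → expTaylor 1ℚ K ≡ expSum K
  expTaylor-1 zero    = refl
  expTaylor-1 (suc K) = cong₂ _+_ (expTaylor-1 K)
    (trans (cong (_* expTerm (suc K)) (1^ (suc K))) (ℚₚ.*-identityˡ _))

  expSum-≤ : ∀ {k m} → k ℕ.≤ m → expSum k ≤ expSum m
  expSum-≤ {k} {m} k≤m = subst (λ z → expSum k ≤ expSum z) (ℕₚ.m+[n∸m]≡n k≤m)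
    (Series.expSum-mono k (m ℕ.∸ k))

  1≤expSum : ∀ m → 1ℚ ≤ expSum m
  1≤expSum m = expSum-≤ {0} {m} ℕ.z≤n

  0≤expSum : ∀ m → 0ℚ ≤ expSum m
  0≤expSum m = ℚₚ.≤-trans 0≤1 (1≤expSum m)

  -- The sum of `expSum m` and 1/m is non-increasing from m = 1 on, where it equals 3.
  expSum≤3 : ∀ m → expSum m ≤ ι 3
  expSum≤3 m = ℚₚ.≤-trans (expSum-≤ (ℕₚ.n≤1+n m))
    (ℚₚ.≤-trans (p≤p+q (0≤/ 1 (suc m))) (Series.expSum-decr 0 m))

  module _ (m : ℕ) where
    open ℚₚ.≤-Reasoning
    private E = expSum m

    -- The inductive step multiplies by (n+1)(1 + 1/n)ⁿ, and `suc-power` with x = 1/n bounds the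
    -- power by `expSum n`. Stating this for the approximant `expSum m`, m ≥ n, makes it applicable
    -- to each late term of the sequence for e.
    n^n≤eⁿn! : ∀ n → n ℕ.≤ m → ι n ^ n ≤ E ^ n * ι (n !)
    n^n≤eⁿn! zero          _   = ℚₚ.≤-refl
    -- Treated apart because the general step divides by the predecessor.
    n^n≤eⁿn! (suc zero)    _   = subst (1ℚ ≤_)
      (sym (trans (ℚₚ.*-identityʳ (E * 1ℚ)) (ℚₚ.*-identityʳ E))) (1≤expSum m)
    n^n≤eⁿn! (suc n@(suc _)) n<m = begin
      ι (suc n) * ι (suc n) ^ n         ≡⟨ cong (λ z → ι (suc n) * z ^ n) (/-suc n 0) ⟩
      ι (suc n) * (ι n + 1ℚ) ^ n
        ≤⟨ *-mono (0≤ι (suc n)) (suc-power (0≤/ 1 n) (0≤ι n)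
             (trans (ℚₚ.*-comm (ℤ.+ 1 / n) (ι n)) (ι*1/ n)) n) ⟩
      ι (suc n) * (ι n ^ n * expTaylor (ι n * (ℤ.+ 1 / n)) n)
        ≡⟨ cong (λ z → ι (suc n) * (ι n ^ n * z))
             (trans (cong (λ z → expTaylor z n) (ι*1/ n)) (expTaylor-1 n)) ⟩
      ι (suc n) * (ι n ^ n * expSum n)
        ≤⟨ *-mono (0≤ι (suc n)) (*-mono₂ (^-nonNeg (0≤ι n) n) (0≤expSum m)
             (n^n≤eⁿn! n (ℕₚ.<⇒≤ n<m)) (expSum-≤ (ℕₚ.<⇒≤ n<m))) ⟩
      ι (suc n) * (E ^ n * ι (n !) * E)
        ≡⟨ solve 4 (λ s p f e → s :* (p :* f :* e) := e :* p :* (s :* f))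
             refl (ι (suc n)) (E ^ n) (ι (n !)) E ⟩
      E ^ suc n * (ι (suc n) * ι (n !)) ≡⟨ cong (E ^ suc n *_) (ι-* (suc n) (n !)) ⟨
      E ^ suc n * ι (suc n !)           ∎

    n^n+j≤eⁿ[n+j]! : ∀ n → n ℕ.≤ m → ∀ j → ι n ^ (j ℕ.+ n) ≤ E ^ n * ι ((j ℕ.+ n) !)
    n^n+j≤eⁿ[n+j]! n n≤m zero    = n^n≤eⁿn! n n≤m
    n^n+j≤eⁿ[n+j]! n n≤m (suc j) = begin
      ι n * ι n ^ M              ≤⟨ *-mono₂ (0≤ι n) (0≤* (^-nonNeg (0≤expSum m) n) (0≤ι (M !)))
                                      (ι-mono (ℕₚ.m≤n+m n (suc j))) (n^n+j≤eⁿ[n+j]! n n≤m j) ⟩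
      ι (suc M) * (E ^ n * ι (M !))
        ≡⟨ solve 3 (λ a b c → a :* (b :* c) := b :* (a :* c)) refl (ι (suc M)) (E ^ n) (ι (M !)) ⟩
      E ^ n * (ι (suc M) * ι (M !)) ≡⟨ cong (E ^ n *_) (ι-* (suc M) (M !)) ⟨
      E ^ n * ι (suc M !)        ∎
      where M = j ℕ.+ n

  -- Bounds on the growth function, term by term.

  seq-^ : ∀ x n m → seq (x ^ℝ n) m ≡ seq x m ^ n
  seq-^ x zero    m = refl
  seq-^ x (suc n) m = cong (seq x m *_) (seq-^ x n m)

  -- The grid approximation rounds down, so no error term is needed at any precision.
  sqrtApprox-≤ : ∀ m {q t} → 0ℚ ≤ t → q ≤ t * t → sqrtApprox m q ≤ t
  sqrtApprox-≤ m {q} {t} 0≤t q≤t² = square-cancel 0≤t (ℚₚ.≤-trans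
    (Sqrt.gridRoot-lower m q (fuel m q)) (ℚₚ.⊔-lub q≤t² (0≤* 0≤t 0≤t)))

  -- The first term is 1 and the rest is minus an alternating sum with decreasing terms, which is
  -- non-negative. Hence every approximant of π is at most 4.
  leibnizSum≤1 : ∀ m → partialSum leibnizTerm m ≤ 1ℚ
  leibnizSum≤1 m = p-q≤ε⇒p≤q+ε {L} {1ℚ} {0ℚ} (subst (_≤ 0ℚ)
    (sym (trans (Series.leibnizSum-tail 0 m)
      (solve 1 (λ a → :- con 1ℚ :* a := :- a) refl A)))
    (ℚₚ.neg-antimono-≤ (proj₁ (Series.alternating-bounds 1 m))))
    where
    L = partialSum leibnizTerm m
    A = Series.alternating 1 m

  -- The reciprocal inverts the capped value `cap`, which is at least `seq x m`; capping can only
  -- lower the quotient.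
  1/ℝ-bound : ∀ x p m {q A} → 0ℚ ≤ A → q ≤ A * seq x m → q * seq (1/ℝ x [ p ]) m ≤ A
  1/ℝ-bound x p@(δ , 0<δ , _) m {q} {A} 0≤A q≤ = begin
    q * inv         ≡⟨ ℚₚ.*-comm q inv ⟩
    inv * q         ≤⟨ *-mono (ℚₚ.<⇒≤ (0<1/ 0<cap)) q≤Acap ⟩
    inv * (A * cap) ≡⟨ solve 3 (λ i a c → i :* (a :* c) := a :* (i :* c)) refl inv A cap ⟩
    A * (inv * cap) ≡⟨ cong (A *_) (ℚₚ.*-inverseˡ cap) ⟩
    A * 1ℚ          ≡⟨ ℚₚ.*-identityʳ A ⟩
    A               ∎
    where
    open ℚₚ.≤-Reasoning
    cap = seq x m Q.⊔ δ
    0<cap : 0ℚ Q.< cap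
    0<cap = ℚₚ.<-≤-trans 0<δ (ℚₚ.p≤q⊔p (seq x m) δ)
    instance
      cap≢0 : Q.NonZero cap
      cap≢0 = Q.>-nonZero 0<cap
    inv = 1/ cap
    q≤Acap : q ≤ A * cap
    q≤Acap = ℚₚ.≤-trans q≤ (*-mono 0≤A (ℚₚ.p≤p⊔q (seq x m) δ))

  module _ (d γ : ℕ) where
    private Δ = suc (suc d)
    open ℚₚ.≤-Reasoning

    -- The exponent Δn+Δ+1 splits as M + n with M = (Δ-1)n+Δ+1, so each of the two factorials in the
    -- denominator absorbs one power of n, at the cost of a factor `E ^ n` each.
    numerator-bound : ∀ n m → n ℕ.≤ m →
      seq (Growth.numerator Δ γ n) m ≤ ι (3 ℕ.* 3 ℕ.^ n) * seq (Growth.denominator Δ γ n) m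
    numerator-bound n m n≤m = begin
      r * (ι N * s)
        ≤⟨ *-mono₂ (Sqrt.0≤s (fromℕ 2 *ℝ π) m) (0≤* (0≤ι N) (0≤ι n)) r≤3
             (*-mono (0≤ι N) s≤n) ⟩
      ι 3 * (ι N * ι n)
        ≡⟨ cong (λ z → ι 3 * (z * ι n)) N≡ ⟩
      ι 3 * (ι n ^ M * ι n ^ n * ι n)
        -- The factor n that bounds √n is raised to n+1, which turns n! into (n+1)!.
        ≤⟨ *-mono (0≤ι 3) (*-mono₂ (0≤* (^-nonNeg (0≤ι n) M) (^-nonNeg (0≤ι n) n)) (0≤ι (suc n))
             (*-mono₂ (^-nonNeg (0≤ι n) M) (0≤* 0≤Eⁿ (0≤ι (n !))) n^M≤ (n^n≤eⁿn! m n n≤m))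
             (ι-mono (ℕₚ.n≤1+n n))) ⟩
      ι 3 * (E ^ n * ι (M !) * (E ^ n * ι (n !)) * ι (suc n))
        -- One factor `E ^ n` stays, to match the eⁿ of the denominator; the other is at most 3ⁿ.
        ≤⟨ *-mono (0≤ι 3) (subst₂ _≤_ (sym shuffle) refl
             (ℚₚ.*-monoʳ-≤-nonNeg X {{Q.nonNegative 0≤X}} (^-mono (0≤expSum m) (expSum≤3 m) n))) ⟩
      ι 3 * (ι 3 ^ n * X)
        ≡⟨ ℚₚ.*-assoc (ι 3) (ι 3 ^ n) X ⟨
      ι 3 * ι 3 ^ n * X
        ≡⟨ cong₂ _*_ (trans (ι-* 3 (3 ℕ.^ n)) (cong (ι 3 *_) (ι-^ 3 n))) refl ⟨
      ι (3 ℕ.* 3 ℕ.^ n) * X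
        ≡⟨ cong (λ z → ι (3 ℕ.* 3 ℕ.^ n) * z) (cong₂ _*_ (seq-^ e n m) F≡) ⟨
      ι (3 ℕ.* 3 ℕ.^ n) * seq (Growth.denominator Δ γ n) m ∎
      where
      E = expSum m
      N = n ℕ.^ (Δ ℕ.* n ℕ.+ Δ ℕ.+ 1)
      M = suc d ℕ.* n ℕ.+ Δ ℕ.+ 1
      r = seq (√ (fromℕ 2 *ℝ π)) m
      s = seq (√ (fromℕ n)) m
      X = E ^ n * (ι (M !) * (ι (suc n) * ι (n !)))
      0≤Eⁿ : 0ℚ ≤ E ^ n
      0≤Eⁿ = ^-nonNeg (0≤expSum m) n
      0≤X : 0ℚ ≤ X
      0≤X = 0≤* 0≤Eⁿ (0≤* (0≤ι (M !)) (0≤* (0≤ι (suc n)) (0≤ι (n !))))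
      r≤3 : r ≤ ι 3
      -- Each approximant of 2π is at most 2 · 4 = 8 ≤ 3².
      r≤3 = sqrtApprox-≤ m (0≤ι 3) (ℚₚ.≤-trans
        (*-mono (0≤ι 2) (*-mono (0≤ι 4) (leibnizSum≤1 m))) (ι-mono {8} {9} (ℕₚ.n≤1+n 8)))
      s≤n : s ≤ ι n
      s≤n = sqrtApprox-≤ m (0≤ι n) (subst (ι n ≤_) (ι-* n n) (ι-mono (n≤n*n n)))
        where
        n≤n*n : ∀ n → n ℕ.≤ n ℕ.* n
        n≤n*n zero    = ℕ.z≤n
        n≤n*n (suc n) = ℕₚ.m≤m*n (suc n) (suc n)
      exponent : Δ ℕ.* n ℕ.+ Δ ℕ.+ 1 ≡ M ℕ.+ n
      exponent = trans (trans (cong (ℕ._+ 1) (ℕₚ.+-assoc n (suc d ℕ.* n) Δ))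
        (ℕₚ.+-assoc n (suc d ℕ.* n ℕ.+ Δ) 1)) (ℕₚ.+-comm n M)
      N≡ : ι N ≡ ι n ^ M * ι n ^ n
      N≡ = trans (cong (λ k → ι (n ℕ.^ k)) exponent)
        (trans (cong ι (ℕₚ.^-distribˡ-+-* n M n))
        (trans (ι-* (n ℕ.^ M) (n ℕ.^ n)) (cong₂ _*_ (ι-^ n M) (ι-^ n n))))
      n≤M : n ℕ.≤ M
      n≤M = ℕₚ.≤-trans (ℕₚ.m≤m+n n (d ℕ.* n))
        (ℕₚ.≤-trans (ℕₚ.m≤m+n (suc d ℕ.* n) Δ) (ℕₚ.m≤m+n _ 1))
      n^M≤ : ι n ^ M ≤ E ^ n * ι (M !)
      n^M≤ = subst (λ k → ι n ^ k ≤ E ^ n * ι (k !)) (ℕₚ.m∸n+n≡m n≤M)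
        (n^n+j≤eⁿ[n+j]! m n n≤m (M ℕ.∸ n))
      shuffle : E ^ n * ι (M !) * (E ^ n * ι (n !)) * ι (suc n) ≡ E ^ n * X
      shuffle = solve 4 (λ p a b c → p :* a :* (p :* b) :* c := p :* (p :* (a :* (c :* b))))
        refl (E ^ n) (ι (M !)) (ι (n !)) (ι (suc n))
      F≡ : ι (M !) * ι ((n ℕ.+ 1) !) ≡ ι (M !) * (ι (suc n) * ι (n !))
      F≡ = cong (ι (M !) *_) (trans (cong (λ k → ι (k !)) (ℕₚ.+-comm n 1)) (ι-* (suc n) (n !)))

    growth-bound : ∀ n m → n ℕ.≤ m → seq (growth Δ γ n) m ≤ ι (3 ℕ.* 3 ℕ.^ n) * ι γ
    growth-bound n m n≤m = ℚₚ.*-monoʳ-≤-nonNeg (ι γ) {{Q.nonNegative (0≤ι γ)}}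
      (1/ℝ-bound (Growth.denominator Δ γ n) (Growth.denominator-positive Δ γ n) m
        (0≤ι (3 ℕ.* 3 ℕ.^ n)) (numerator-bound n m n≤m))

  -- Explains the constant 1/(9γ): one factor 3 comes from √(2π) ≤ 3, the other from n = k+1
  -- subcovers giving only k letters.
  scale : ∀ γ .{{_ : ℕ.NonZero (9 ℕ.* γ)}} k →
    (ℤ.+ 1 / (9 ℕ.* γ)) * (ι (3 ℕ.* 3 ℕ.^ suc k) * ι γ) ≡ ι (3 ℕ.^ k)
  scale γ k = begin
    C * (ι (3 ℕ.* 3 ℕ.^ suc k) * ι γ)    ≡⟨ cong (C *_) (ι-* (3 ℕ.* 3 ℕ.^ suc k) γ) ⟨
    C * ι (3 ℕ.* 3 ℕ.^ suc k ℕ.* γ)      ≡⟨ cong (λ z → C * ι z) regroup ⟩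
    C * ι (9 ℕ.* γ ℕ.* 3 ℕ.^ k)          ≡⟨ cong (C *_) (ι-* (9 ℕ.* γ) (3 ℕ.^ k)) ⟩
    C * (ι (9 ℕ.* γ) * ι (3 ℕ.^ k))
      ≡⟨ solve 3 (λ c a b → c :* (a :* b) := (a :* c) :* b) refl C (ι (9 ℕ.* γ)) (ι (3 ℕ.^ k)) ⟩
    (ι (9 ℕ.* γ) * C) * ι (3 ℕ.^ k)      ≡⟨ cong (_* ι (3 ℕ.^ k)) (ι*1/ (9 ℕ.* γ)) ⟩
    1ℚ * ι (3 ℕ.^ k)                     ≡⟨ ℚₚ.*-identityˡ (ι (3 ℕ.^ k)) ⟩
    ι (3 ℕ.^ k)                          ∎
    where
    open ≡-Reasoning
    C = ℤ.+ 1 / (9 ℕ.* γ)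
    regroup : 3 ℕ.* 3 ℕ.^ suc k ℕ.* γ ≡ 9 ℕ.* γ ℕ.* 3 ℕ.^ k
    regroup = ℕSolver.solve 2
      (λ p g → ℕSolver.con 3 ℕSolver.:* (ℕSolver.con 3 ℕSolver.:* p) ℕSolver.:* g
         ℕSolver.:= ℕSolver.con 9 ℕSolver.:* g ℕSolver.:* p) refl (3 ℕ.^ k) γ

  fromℚ-positive : ∀ {q} → 0ℚ Q.< q → Positiveℝ (fromℚ q)
  fromℚ-positive {q} 0<q = q , 0<q , 0 , λ _ _ → ℚₚ.≤-refl

  eventually⇒≤ℝ : ∀ x y N → (∀ m → N ℕ.≤ m → seq x m ≤ seq y m) → x ≤ℝ y
  eventually⇒≤ℝ x y N h 0<ε = N , λ m N≤m → ℚₚ.≤-trans (h m N≤m) (p≤p+q (ℚₚ.<⇒≤ 0<ε))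

open import Data.Bool.Base using (false; T)
open import Data.Empty using (⊥-elim)
open import Data.Fin.Base using (Fin; zero; suc; punchIn; remQuot; combine)
import Data.Fin.Properties as Finₚ
import Data.Product.Properties as ×ₚ
open import Data.Sum.Base using (_⊎_; inj₁; inj₂)
open import Data.Vec.Base using (Vec; []; _∷_; head; tail)
open import Function.Base using (_∘_)
open import Function.Bundles using (Inverse)
open import Relation.Binary.Bundles using (Setoid)
open import Relation.Binary.Construct.Closure.ReflexiveTransitive using (Star; ε; _◅_; _◅◅_)
open import Relation.Binary.Construct.Closure.Transitive using ([_]; _∷_)
open import Relation.Nullary using (Dec; yes; no; ¬_; contradiction)
open import Relation.Nullary.Decidable using (toWitness; fromWitness; map′; _×-dec_; ¬?; ⌊_⌋)

-- The order of the tree.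

module Tree (Δ g : ℕ) where

  -- Only positive γ is treated here; for γ = 0 the growth function vanishes.
  γ : ℕ
  γ = suc g

  V : Set
  V = Node Δ γ

  Star-node : Set
  Star-node = NodeAt Δ γ 0

  infix 4 _⋖_ _≼_ _≺_
  _⋖_ _≼_ _≺_ : V → V → Set
  _⋖_ = ParentOf Δ γ
  _≼_ = Star _⋖_
  _≺_ = AncestorOf Δ γ

  child : Star-node → Fin Δ → V
  child u i = γ , branch u i

  ≺⇒≼ : ∀ {x y} → x ≺ y → x ≼ y
  ≺⇒≼ [ p ]   = p ◅ ε
  ≺⇒≼ (p ∷ q) = p ◅ ≺⇒≼ q

  ⋖-≼-trans : ∀ {x y z} → x ⋖ y → y ≼ z → x ≺ z
  ⋖-≼-trans p ε       = [ p ]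
  ⋖-≼-trans p (q ◅ r) = p ∷ ⋖-≼-trans q r

  ≼-split : ∀ {x y} → x ≼ y → x ≡ y ⊎ x ≺ y
  ≼-split ε       = inj₁ refl
  ≼-split (p ◅ q) = inj₂ (⋖-≼-trans p q)

  ≺-≼-trans : ∀ {x y z} → x ≺ y → y ≼ z → x ≺ z
  ≺-≼-trans [ p ]   q = ⋖-≼-trans p q
  ≺-≼-trans (p ∷ r) q = p ∷ ≺-≼-trans r q

  ≼-≺-trans : ∀ {x y z} → x ≼ y → y ≺ z → x ≺ z
  ≼-≺-trans ε       q = q
  ≼-≺-trans (p ◅ r) q = p ∷ ≼-≺-trans r q

  height : ∀ {k} → NodeAt Δ γ k → ℕ
  height root         = 0
  height (along u)    = suc (height u)
  height (branch u i) = suc (height u)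

  depth : V → ℕ
  depth (_ , x) = height x

  ⋖-depth : ∀ {x y} → x ⋖ y → depth y ≡ suc (depth x)
  ⋖-depth (along u)    = refl
  ⋖-depth (branch u i) = refl

  ≺-depth : ∀ {x y} → x ≺ y → depth x ℕ.< depth y
  ≺-depth [ p ]   = ℕₚ.≤-reflexive (sym (⋖-depth p))
  ≺-depth (p ∷ q) = ℕₚ.<-trans (ℕₚ.≤-reflexive (sym (⋖-depth p))) (≺-depth q)

  ≺-irrefl : ∀ {x} → ¬ x ≺ x
  ≺-irrefl p = ℕₚ.<-irrefl refl (≺-depth p)

  parent-unique : ∀ {p q x} → p ⋖ x → q ⋖ x → p ≡ q
  parent-unique (along u)    (along .u)     = refl
  parent-unique (branch u i) (branch .u .i) = refl

  parent-or-root : ∀ x → (∃[ p ] p ⋖ x) ⊎ x ≡ rootNode Δ γ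
  parent-or-root (_ , root)       = inj₂ refl
  parent-or-root (_ , along u)    = inj₁ (_ , along u)
  parent-or-root (_ , branch u i) = inj₁ (_ , branch u i)

  last-step : ∀ {x y} → x ≺ y → ∃[ p ] x ≼ p × p ⋖ y
  last-step [ p ]   = _ , ε , p
  last-step (p ∷ q) = let r , s , t = last-step q in r , p ◅ s , t

  siblings-incomparable : ∀ {p x y} → p ⋖ x → p ⋖ y → ¬ x ≺ y
  siblings-incomparable p⋖x p⋖y x≺y =
    ℕₚ.<-irrefl (trans (⋖-depth p⋖x) (sym (⋖-depth p⋖y))) (≺-depth x≺y)

  -- Parents are unique, so a node strictly above a child of `x` lies weakly above `x` itself.
  ancestors-chain : ∀ {x y z} → x ≼ z → y ≼ z → x ≼ y ⊎ y ≼ x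
  ancestors-chain ε       y≼z = inj₂ y≼z
  ancestors-chain (p ◅ q) y≼z with ancestors-chain q y≼z
  ... | inj₁ x′≼y = inj₁ (p ◅ x′≼y)
  ... | inj₂ y≼x′ with ≼-split y≼x′
  ...   | inj₁ refl = inj₁ (p ◅ ε)
  ...   | inj₂ y≺x′ = let r , y≼r , r⋖x′ = last-step y≺x′ in
                      inj₂ (subst (_ ≼_) (parent-unique r⋖x′ p) y≼r)

  child-⋠ : ∀ {u i j} → i ≢ j → ¬ child u i ≼ child u j
  child-⋠ i≢j h with ≼-split h
  ... | inj₁ refl = i≢j refl
  ... | inj₂ h′   = siblings-incomparable (branch _ _) (branch _ _) h′

  -- Two children above the same node would be comparable, but siblings have equal depth.
  child-unique : ∀ {u i j v} → i ≢ j → child u i ≼ v → ¬ child u j ≼ v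
  child-unique i≢j a b with ancestors-chain a b
  ... | inj₁ h = child-⋠ i≢j h
  ... | inj₂ h = child-⋠ (i≢j ∘ sym) h

  root-≼ : ∀ {k} (x : NodeAt Δ γ k) → rootNode Δ γ ≼ (k , x)
  root-≼ root         = ε
  root-≼ (along u)    = root-≼ u ◅◅ along u ◅ ε
  root-≼ (branch u i) = root-≼ u ◅◅ branch u i ◅ ε

  starBelow : ∀ k → NodeAt Δ γ k → Star-node
  starBelow zero    x = x
  starBelow (suc k) x = starBelow k (along x)

  ≼-starBelow : ∀ k x → (k , x) ≼ (0 , starBelow k x)
  ≼-starBelow zero    x = ε
  ≼-starBelow (suc k) x = along x ◅ ≼-starBelow k (along x)

  -- The path down to the star node does not branch: a descent from `x` either stops on it or runs
  -- through its end.
  starBelow-comparable : ∀ k x {v} → (k , x) ≼ v →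
    v ≼ (0 , starBelow k x) ⊎ (0 , starBelow k x) ≼ v
  starBelow-comparable k       x ε             = inj₁ (≼-starBelow k x)
  starBelow-comparable zero    x (p ◅ q)       = inj₂ (p ◅ q)
  starBelow-comparable (suc k) x (along _ ◅ q) = starBelow-comparable k (along x) q

  -- Decidable sets of nodes, and alphabets.

  _≟ᴺ_ : ∀ {k} (x y : NodeAt Δ γ k) → Dec (x ≡ y)
  root       ≟ᴺ root       = yes refl
  root       ≟ᴺ along _    = no λ ()
  root       ≟ᴺ branch _ _ = no λ ()
  along _    ≟ᴺ root       = no λ ()
  along x    ≟ᴺ along y    = map′ (cong along) (λ { refl → refl }) (x ≟ᴺ y)
  along _    ≟ᴺ branch _ _ = no λ ()
  branch _ _ ≟ᴺ root       = no λ ()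
  branch _ _ ≟ᴺ along _    = no λ ()
  branch u i ≟ᴺ branch v j =
    map′ (λ { (refl , refl) → refl }) (λ { refl → refl , refl }) (u ≟ᴺ v ×-dec i Finₚ.≟ j)

  _≟_ : (x y : V) → Dec (x ≡ y)
  _≟_ = ×ₚ.≡-dec ℕₚ._≟_ _≟ᴺ_

  single : V → Subset Δ γ
  single x v = ⌊ v ≟ x ⌋

  childrenExcept : Fin Δ → Star-node → Subset Δ γ
  childrenExcept r u (_ , root)       = false
  childrenExcept r u (_ , along _)    = false
  childrenExcept r u (_ , branch v i) = ⌊ v ≟ᴺ u ×-dec ¬? (i Finₚ.≟ r) ⌋

  childrenExcept⁺ : ∀ {r u i} → i ≢ r → T (childrenExcept r u (child u i))
  childrenExcept⁺ i≢r = fromWitness (refl , i≢r)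

  childrenExcept⁻ : ∀ {r u} v → T (childrenExcept r u v) → ∃[ i ] i ≢ r × v ≡ child u i
  childrenExcept⁻ (_ , branch _ i) t with toWitness t
  ... | refl , i≢r = i , i≢r , refl

  Meets : Subset Δ γ → V → Set
  Meets A v = ∃[ x ] T (A x) × (v ≼ x ⊎ x ≼ v)

  -- A letter a, read at a Δ-star node u, covers all children of u except
  -- `continue a` with the single subcover `block a u`.
  record Alphabet (s : ℕ) : Set where
    field
      continue  : Fin s → Fin Δ
      block     : Fin s → Star-node → Subset Δ γ
      nonEmpty  : ∀ a u → ∃[ v ] T (block a u v)
      siblings  : ∀ a u → ∃[ p ] ∀ v → T (block a u v) → p ⋖ v
      offside   : ∀ a u v → T (block a u v) → ∃[ i ] i ≢ continue a × child u i ≼ v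
      covering  : ∀ a u i → i ≢ continue a → ∀ v → child u i ≼ v → Meets (block a u) v

    -- Some node `v` in the block of `a` lies strictly above a node of every cover that starts with
    -- `b`: either above the block of `b`, or weakly above the child where `b` continues. Being an
    -- antichain, such a cover omits `v`.
    Separates : Star-node → Fin s → Fin s → Set
    Separates u a b = ∃[ v ] T (block a u v) ×
      (v ≼ child u (continue b) ⊎ ∃[ w ] T (block b u w) × v ≺ w)

    field
      separated : ∀ {a b} u → a ≢ b → Separates u a b ⊎ Separates u b a

  -- Sweep-covers built from words.

  module Spine {s} (𝒜 : Alphabet s) where
    open Alphabet 𝒜

    next : Fin s → Star-node → Star-node
    next a u = starBelow γ (branch u (continue a))

    cover : ∀ {m} → Vec (Fin s) m → Star-node → Fin (suc m) → Subset Δ γ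
    cover []      u _       = single (0 , u)
    cover (a ∷ w) u zero    = block a u
    cover (a ∷ w) u (suc i) = cover w (next a u) i

    child-≼-next : ∀ a u {v} → (0 , next a u) ≼ v → child u (continue a) ≼ v
    child-≼-next a u h = ≼-starBelow γ _ ◅◅ h

    cover-nonEmpty : ∀ {m} (w : Vec (Fin s) m) u i → ∃[ v ] T (cover w u i v)
    cover-nonEmpty []      u _       = (0 , u) , fromWitness refl
    cover-nonEmpty (a ∷ w) u zero    = nonEmpty a u
    cover-nonEmpty (a ∷ w) u (suc i) = cover-nonEmpty w (next a u) i

    cover-below : ∀ {m} (w : Vec (Fin s) m) u i v → T (cover w u i v) → (0 , u) ≼ v
    cover-below []      u _       v t with refl ← toWitness t = ε
    cover-below (a ∷ w) u zero    v t = let _ , _ , h = offside a u v t in branch u _ ◅ h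
    cover-below (a ∷ w) u (suc i) v t =
      branch u _ ◅ child-≼-next a u (cover-below w (next a u) i v t)

    -- The block lies under children other than the continued one and `next a u` lies under the
    -- continued one; subtrees of distinct children are disjoint.
    block-vs-below : ∀ a u {x v} → T (block a u x) → x ≼ v → ¬ (0 , next a u) ≼ v
    block-vs-below a u t x≼v h = let _ , i≢r , c = offside a u _ t in
      child-unique i≢r (c ◅◅ x≼v) (child-≼-next a u h)

    cover-disjoint : ∀ {m} (w : Vec (Fin s) m) u i j → i ≢ j →
      ∀ v → T (cover w u i v) → ¬ T (cover w u j v)
    cover-disjoint []      u zero    zero    i≢j v p q = i≢j refl
    cover-disjoint (a ∷ w) u zero    zero    i≢j v p q = i≢j refl
    cover-disjoint (a ∷ w) u zero    (suc j) i≢j v p q =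
      block-vs-below a u p ε (cover-below w _ j v q)
    cover-disjoint (a ∷ w) u (suc i) zero    i≢j v p q =
      block-vs-below a u q ε (cover-below w _ i v p)
    cover-disjoint (a ∷ w) u (suc i) (suc j) i≢j v p q =
      cover-disjoint w (next a u) i j (i≢j ∘ cong suc) v p q

    cover-siblings : ∀ {m} (w : Vec (Fin s) m) u i →
      (∃[ p ] ∀ v → T (cover w u i v) → p ⋖ v) ⊎ (∀ v → T (cover w u i v) → v ≡ rootNode Δ γ)
    cover-siblings [] u _ with parent-or-root (0 , u)
    ... | inj₁ (p , h) = inj₁ (p , λ v t → subst (p ⋖_) (sym (toWitness t)) h)
    ... | inj₂ u≡root  = inj₂ λ v t → trans (toWitness t) u≡root
    cover-siblings (a ∷ w) u zero    = inj₁ (siblings a u)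
    cover-siblings (a ∷ w) u (suc i) = cover-siblings w (next a u) i

    -- Comparability with the current star node is the invariant. Under the continued child,
    -- `starBelow-comparable` restores it for the next star node; under any other child, the block
    -- itself is met.
    cover-meets : ∀ {m} (w : Vec (Fin s) m) u v → v ≼ (0 , u) ⊎ (0 , u) ≼ v →
      ∃[ i ] Meets (cover w u i) v
    cover-meets w u v (inj₁ v≼u) =
      let x , t = cover-nonEmpty w u zero in
      zero , x , t , inj₁ (v≼u ◅◅ cover-below w u zero x t)
    cover-meets []      u v (inj₂ u≼v) = zero , (0 , u) , fromWitness refl , inj₂ u≼v
    cover-meets (a ∷ w) u v (inj₂ ε)   = cover-meets (a ∷ w) u v (inj₁ ε)
    cover-meets (a ∷ w) u v (inj₂ (branch _ i ◅ h)) with i Finₚ.≟ continue a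
    ... | no i≢r   = zero , covering a u i i≢r v h
    ... | yes refl = let j , m = cover-meets w (next a u) v (starBelow-comparable γ _ h) in
                     suc j , m

    cover-antichain : ∀ {m} (w : Vec (Fin s) m) u i j x y →
      T (cover w u i x) → T (cover w u j y) → ¬ x ≺ y
    cover-antichain []      u _       _       x y p q x≺y
      with refl ← toWitness p | refl ← toWitness q = ≺-irrefl x≺y
    cover-antichain (a ∷ w) u zero    zero    x y p q x≺y =
      let _ , h = siblings a u in siblings-incomparable (h x p) (h y q) x≺y
    cover-antichain (a ∷ w) u zero    (suc j) x y p q x≺y =
      block-vs-below a u p (≺⇒≼ x≺y) (cover-below w _ j y q)
    cover-antichain (a ∷ w) u (suc i) zero    x y p q x≺y =
      block-vs-below a u q ε (cover-below w _ i x p ◅◅ ≺⇒≼ x≺y)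
    cover-antichain (a ∷ w) u (suc i) (suc j) x y p q x≺y =
      cover-antichain w (next a u) i j x y p q x≺y

    -- Compares unions of subcovers only: the set of covered nodes already determines the word.
    Within : ∀ {m} (w w′ : Vec (Fin s) m) → Star-node → Set
    Within w w′ u = ∀ v → ∃[ i ] T (cover w u i v) → ∃[ j ] T (cover w′ u j v)

    ¬-separates : ∀ {m a b} {w w′ : Vec (Fin s) m} {u} →
      Within (a ∷ w) (b ∷ w′) u → ¬ Separates u a b
    ¬-separates {b = b} {w′ = w′} {u} sub (v , t , below) with sub v (zero , t)
    ... | j , t′ with below
    ...   | inj₂ (x , tx , v≺x) = cover-antichain (b ∷ w′) u j zero v x t′ tx v≺x
    ...   | inj₁ v≼c =
      let y , ty = cover-nonEmpty w′ (next b u) zero in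
      cover-antichain (b ∷ w′) u j (suc zero) v y t′ ty
        -- As γ is positive, the next star node is strictly below the child, even when `v` is that
        -- child.
        (≺-≼-trans (≼-≺-trans v≼c (⋖-≼-trans (along _) (≼-starBelow g _)))
                   (cover-below w′ (next b u) zero y ty))

    within-tail : ∀ {m a} {w w′ : Vec (Fin s) m} {u} →
      Within (a ∷ w) (a ∷ w′) u → Within w w′ (next a u)
    within-tail {a = a} {w} {u = u} sub v (i , t) with sub v (suc i , t)
    ... | zero  , t′ = ⊥-elim (block-vs-below a u t′ ε (cover-below w _ i v t))
    ... | suc j , t′ = j , t′

    cover-injective : ∀ {m} (w w′ : Vec (Fin s) m) u →
      Within w w′ u → Within w′ w u → w ≡ w′
    cover-injective []      []        u p q = refl
    cover-injective (a ∷ w) (b ∷ w′) u p q with a Finₚ.≟ b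
    ... | yes refl = cong (a ∷_)
                       (cover-injective w w′ (next a u) (within-tail p) (within-tail q))
    -- Separation is one-sided, so either of the two inclusions may be the one refuted.
    ... | no a≢b with separated u a≢b
    ...   | inj₁ h = ⊥-elim (¬-separates p h)
    ...   | inj₂ h = ⊥-elim (¬-separates q h)

    firstStar : Star-node
    firstStar = starBelow γ root

    sweepCover : ∀ {m} → Vec (Fin s) m → SweepCover Δ γ (suc m)
    sweepCover w = record
      { subcover  = cover w firstStar
      ; nonEmpty  = cover-nonEmpty w firstStar
      ; disjoint  = cover-disjoint w firstStar
      ; siblings  = cover-siblings w firstStar
      ; covering  = covering′
      ; antichain = λ x y (i , p) (j , q) → cover-antichain w firstStar i j x y p q
      }
      where
      covering′ : ∀ v → _
      covering′ v@(_ , x)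
        with cover-meets w firstStar v (starBelow-comparable γ root (root-≼ x))
      ... | i , y , t , inj₁ v≼y with ≼-split v≼y
      ...   | inj₁ refl = inj₁ (i , t)
      ...   | inj₂ v≺y  = inj₂ (inj₁ (y , (i , t) , v≺y))
      covering′ v@(_ , x) | i , y , t , inj₂ y≼v with ≼-split y≼v
      ...   | inj₁ refl = inj₁ (i , t)
      ...   | inj₂ y≺v  = inj₂ (inj₂ (y , (i , t) , y≺v))

    sweepCover-injective : ∀ {m} (w w′ : Vec (Fin s) m) →
      let _⊑_ = _⊑_ Δ γ in
      sweepCover w ⊑ sweepCover w′ → sweepCover w′ ⊑ sweepCover w → w ≡ w′
    sweepCover-injective w w′ p q = cover-injective w w′ firstStar (within {w} {w′} p) (within {w′} {w} q)
      where
      within : ∀ {w w′} → (_⊑_ Δ γ) (sweepCover w) (sweepCover w′) → Within w w′ firstStar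
      within sub v (i , t) = let j , e = sub i in j , subst T (e v) t

-- Enumeration of words by digits in base `s`.

word : ∀ {s} m → Fin (s ℕ.^ m) → Vec (Fin s) m
word     zero    _ = []
word {s} (suc m) i = let a , j = remQuot {s} (s ℕ.^ m) i in a ∷ word m j

word-injective : ∀ {s} m {i j : Fin (s ℕ.^ m)} → word m i ≡ word m j → i ≡ j
word-injective     zero    {zero} {zero} _  = refl
word-injective {s} (suc m) {i}    {j}    eq = begin
  i                                       ≡⟨ Finₚ.combine-remQuot {s} (s ℕ.^ m) i ⟨
  uncurry combine (remQuot {s} (s ℕ.^ m) i)
    ≡⟨ cong₂ combine (cong head eq) (word-injective m (cong tail eq)) ⟩
  uncurry combine (remQuot {s} (s ℕ.^ m) j) ≡⟨ Finₚ.combine-remQuot {s} (s ℕ.^ m) j ⟩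
  j                                       ∎
  where open ≡-Reasoning

-- The alphabets with Δ letters and, for Δ = 2, with three letters.

module _ (d g : ℕ) where
  open Tree (suc (suc d)) g

  childrenExcept-siblings : ∀ r u → ∃[ p ] ∀ v → T (childrenExcept r u v) → p ⋖ v
  childrenExcept-siblings r u = (0 , u) , λ v t →
    let i , _ , v≡ = childrenExcept⁻ {r} v t in subst (_ ⋖_) (sym v≡) (branch u i)

  -- For distinct letters, the child below which `b` continues belongs to the block of `a`, which
  -- separates them.
  omitOneChild : Alphabet (suc (suc d))
  omitOneChild = record
    { continue  = λ r → r
    ; block     = childrenExcept
    ; nonEmpty  = λ r u → child u (punchIn r zero) , childrenExcept⁺ (Finₚ.punchInᵢ≢i r zero)
    ; siblings  = childrenExcept-siblings
    ; offside   = λ r u v t → let i , i≢r , v≡ = childrenExcept⁻ {r} v t in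
                  i , i≢r , subst (child u i ≼_) (sym v≡) ε
    ; covering  = λ r u i i≢r v h → child u i , childrenExcept⁺ i≢r , inj₂ h
    ; separated = λ {a} {b} u a≢b →
                    inj₁ (child u b , childrenExcept⁺ (a≢b ∘ sym) , inj₁ ε)
    }

module _ (g : ℕ) where
  open Tree 2 g
  open Alphabet (omitOneChild 0 g)

  -- With two children, omitting one of them gives only two letters; the third
  -- one covers the other child's subtree one step further down.
  binaryAlphabet : Alphabet 3
  binaryAlphabet = record
    { continue  = continue₃
    ; block     = block₃
    ; nonEmpty  = λ { zero u → nonEmpty zero u ; (suc zero) u → nonEmpty (suc zero) u
                    ; (suc (suc zero)) u → grandchild u , fromWitness refl }
    ; siblings  = λ { zero u → siblings zero u ; (suc zero) u → siblings (suc zero) u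
                    ; (suc (suc zero)) u → child u (suc zero) , λ v t →
                        subst (child u (suc zero) ⋖_) (sym (toWitness t)) (along _) }
    ; offside   = λ { zero u v t → offside zero u v t
                    ; (suc zero) u v t → offside (suc zero) u v t
                    ; (suc (suc zero)) u v t → suc zero , (λ ()) ,
                        subst (child u (suc zero) ≼_) (sym (toWitness t)) (along _ ◅ ε) }
    ; covering  = covering₃
    ; separated = λ {a} {b} u a≢b → separated₃ a b u a≢b
    }
    where
    grandchild : Star-node → V
    grandchild u = g , along (branch u (suc zero))

    continue₃ : Fin 3 → Fin 2
    continue₃ (suc zero) = suc zero
    continue₃ _          = zero

    block₃ : Fin 3 → Star-node → Subset 2 γ
    block₃ zero             u = childrenExcept zero u
    block₃ (suc zero)       u = childrenExcept (suc zero) u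
    block₃ (suc (suc zero)) u = single (grandchild u)

    covering₃ : ∀ a u i → i ≢ continue₃ a → ∀ v → child u i ≼ v → Meets (block₃ a u) v
    covering₃ zero             u i i≢r v h = covering zero u i i≢r v h
    covering₃ (suc zero)       u i i≢r v h = covering (suc zero) u i i≢r v h
    covering₃ (suc (suc zero)) u zero i≢r v h = contradiction refl i≢r
    -- The child `suc zero` has `grandchild u` as its only child, so a node of its subtree is either
    -- that child or weakly below `grandchild u`.
    covering₃ (suc (suc zero)) u (suc zero) _ v ε =
      grandchild u , fromWitness refl , inj₁ (along _ ◅ ε)
    covering₃ (suc (suc zero)) u (suc zero) _ v (along _ ◅ h) =
      grandchild u , fromWitness refl , inj₂ h

    Sep : Star-node → Fin 3 → Fin 3 → Set
    Sep u a b = ∃[ v ] T (block₃ a u v) ×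
      (v ≼ child u (continue₃ b) ⊎ ∃[ w ] T (block₃ b u w) × v ≺ w)

    -- The child `zero` forms the block of the letter `suc zero`, and both other letters continue
    -- below it.
    child₀ : ∀ u b → continue₃ b ≡ zero → Sep u (suc zero) b
    child₀ u b eq = child u zero , childrenExcept⁺ (λ ()) ,
      inj₁ (subst (λ r → child u zero ≼ child u r) (sym eq) ε)

    -- The child `suc zero` forms the block of the letter `zero`. The letter `suc zero` continues
    -- below it, and the third letter covers its only child.
    child₁ : ∀ u b → T (block₃ b u (grandchild u)) ⊎ continue₃ b ≡ suc zero → Sep u zero b
    child₁ u b (inj₁ t)  = child u (suc zero) , childrenExcept⁺ (λ ()) ,
      inj₂ (grandchild u , t , [ along _ ])
    child₁ u b (inj₂ eq) = child u (suc zero) , childrenExcept⁺ (λ ()) ,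
      inj₁ (subst (λ r → child u (suc zero) ≼ child u r) (sym eq) ε)

    separated₃ : ∀ a b u → a ≢ b → Sep u a b ⊎ Sep u b a
    separated₃ zero             zero             u a≢b = contradiction refl a≢b
    separated₃ zero             (suc zero)       u _   = inj₁ (child₁ u _ (inj₂ refl))
    separated₃ zero             (suc (suc zero)) u _   =
      inj₁ (child₁ u (suc (suc zero)) (inj₁ (fromWitness refl)))
    separated₃ (suc zero)       zero             u _   = inj₁ (child₀ u zero refl)
    separated₃ (suc zero)       (suc zero)       u a≢b = contradiction refl a≢b
    separated₃ (suc zero)       (suc (suc zero)) u _   = inj₁ (child₀ u (suc (suc zero)) refl)
    separated₃ (suc (suc zero)) zero             u _   =
      inj₂ (child₁ u (suc (suc zero)) (inj₁ (fromWitness refl)))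
    separated₃ (suc (suc zero)) (suc zero)       u _   = inj₂ (child₀ u (suc (suc zero)) refl)
    separated₃ (suc (suc zero)) (suc (suc zero)) u a≢b = contradiction refl a≢b

-- Lower bounds on the number of sweep-covers, and the theorem.

alphabet-bound : ∀ {Δ g s p m} → Tree.Alphabet Δ g s →
  HasCardinality (SweepCovers Δ (suc g) (suc m)) p → s ℕ.^ m ℕ.≤ p
alphabet-bound {Δ} {g} {s} {p} {m} 𝒜 card = Finₚ.injective⇒≤ {f = f} f-injective
  where
  open Inverse card
  open Tree.Spine Δ g 𝒜
  f : Fin (s ℕ.^ m) → Fin p
  f i = from (sweepCover (word m i))
  f-injective : ∀ {i j} → f i ≡ f j → i ≡ j
  f-injective {i} {j} eq = word-injective m
    (sweepCover-injective (word m i) (word m j) (proj₁ same) (proj₂ same))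
    where
    open Setoid (SweepCovers Δ (suc g) (suc m))
      using () renaming (_≈_ to _≈ˢ_; sym to symˢ; trans to transˢ)
    -- Covers with the same index are equal as collections, because `to` undoes `from` up to
    -- reordering.
    same : sweepCover (word m i) ≈ˢ sweepCover (word m j)
    same = transˢ {sweepCover (word m i)} {to (f i)} {sweepCover (word m j)}
      (symˢ {to (f i)} {sweepCover (word m i)} (strictlyInverseˡ (sweepCover (word m i))))
      (inverseˡ eq)

sweepCovers-bound : ∀ {Δ g p m} → 2 ℕ.≤ Δ →
  HasCardinality (SweepCovers Δ (suc g) (suc m)) p → 3 ℕ.^ m ℕ.≤ p
sweepCovers-bound {suc (suc zero)}    {g} 2≤Δ card = alphabet-bound (binaryAlphabet g) card
sweepCovers-bound {Δ@(suc (suc (suc d)))} {g} {m = m} 2≤Δ card = ℕₚ.≤-trans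
  (ℕₚ.^-monoˡ-≤ m (ℕ.s≤s (ℕ.s≤s (ℕ.s≤s ℕ.z≤n)))) (alphabet-bound (omitOneChild (suc d) g) card)
sweepCovers-bound {suc zero} (ℕ.s≤s ())

open import Data.Nat.Base using (_≤_)

theorem3 : (Δ γ : ℕ) → 2 ≤ Δ →
    (P : ℕ → ℕ) → (∀ n → HasCardinality (SweepCovers Δ γ n) (P n)) →
    (λ n → fromℕ (P n)) ∈Ω growth Δ γ
theorem3 (suc zero) _ (ℕ.s≤s ()) P card
-- The factor γ = 0 brings the upper bound on the growth function down to 0, so the constant 1
-- serves.
theorem3 Δ@(suc (suc d)) zero 2≤Δ P card = fromℕ 1 , fromℕ-positive 1 , 0 , λ n _ →
  eventually⇒≤ℝ (fromℕ 1 *ℝ growth Δ 0 n) (fromℕ (P n)) n λ m n≤m →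
    ℚₚ.≤-trans (Lemmas.*-mono 0≤1 (growth-bound d 0 n m n≤m))
    (ℚₚ.≤-trans (ℚₚ.≤-reflexive (1*[q*0]≡0 (ι (3 ℕ.* 3 ℕ.^ n)))) (0≤ι (P n)))
  where
  open Numeric
  1*[q*0]≡0 : ∀ q → ι 1 Q.* (q Q.* 0ℚ) ≡ 0ℚ
  1*[q*0]≡0 q = trans (ℚₚ.*-identityˡ (q Q.* 0ℚ)) (ℚₚ.*-zeroʳ q)
theorem3 Δ@(suc (suc d)) γ@(suc g) 2≤Δ P card =
  -- Starting at n = 1 lets n be written as k+1 with k letters. The comparison of sequences starts
  -- at index n, where the bounds with `expSum m` become valid.
  fromℚ C , fromℚ-positive 0<C , 1 , λ { n@(suc k) _ →
    eventually⇒≤ℝ (fromℚ C *ℝ growth Δ γ n) (fromℕ (P n)) n λ m n≤m →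
      ℚₚ.≤-trans (Lemmas.*-mono (ℚₚ.<⇒≤ 0<C) (growth-bound d γ n m n≤m))
      (ℚₚ.≤-trans (ℚₚ.≤-reflexive (scale γ k))
                  (ι-mono (sweepCovers-bound {m = k} 2≤Δ (card n)))) }
  where
  open Numeric
  C = ℤ.+ 1 Q./ (9 ℕ.* γ)
  0<C : 0ℚ Q.< C
  0<C = ℚₚ.positive⁻¹ C {{ℚₚ.normalize-pos 1 (9 ℕ.* γ)}}
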